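{- Let $X$ be a finite set and $S$ a set of subsets of $X\times X$ such that $(X,S)$ satisfies (CC1), (CC2) and (CC3), and let $(S,\nabla,e)$ be the associated monoid in $\mathbf{Mat}_{\mathbb R_0^+}$. Let $f\colon S\to I$ be a morphism in $\mathbf{Mat}_{\mathbb R_0^+}$ such that, for $a\in S$, $f_a^*>0$ if and only if $a\subseteq\mathrm{id}_X$. Then $f$ is a non-degenerate form on $(S,\nabla,e)$ if and only if $(X,S)$ is a coherent configuration, i.e. if and only if $(X,S)$ also satisfies (CC4).
   Context: $\mathbf{Mat}_{\mathbb R_0^+}$ is the category whose objects are finite sets and whose morphisms $f\colon X\to Y$ are matrices $(f_x^y)_{x\in X,y\in Y}$ of non-negative reals, with composition $(g\circ f)_a^c=\sum_{b}f_a^b g_b^c$. It is symmetric monoidal with $X\otimes Y=X\times Y$, $(f\otimes g)_{ac}^{bd}=f_a^b g_c^d$, unit object $I=\{*\}$, and structural isomorphisms (unitors $\lambda_A\colon I\otimes A\to A$, $\rho_A\colon A\otimes I\to A$, etc.) transferred from the cartesian structure on finite sets. Conditions on $(X,S)$ with $S$ a set of subsets of $X\times X$: (CC1) $S$ is a partition of $X\times X$. (CC2) If $p\in S$ and $(x,x)\in p$ for some $x$, then $p\subseteq\mathrm{id}_X$. (CC3) For $a,b,c\in S$ and $(x,y)\in c$, the number $\nabla_{ab}^c$ of $z\in X$ such that $(x,z)\in a$ and $(z,y)\in b$ does not depend on the choice of $(x,y)\in c$. (CC4) If $c\in S$ then $c^{ -1}=\{(y,x):(x,y)\in c\}\in S$.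 A coherent configuration is a pair satisfying (CC1)–(CC4). For $(X,S)$ satisfying (CC1)–(CC3), the associated monoid is $(S,\nabla,e)$ with $\nabla\colon S\otimes S\to S$ the matrix of the numbers $\nabla_{ab}^c$, and $e\colon I\to S$ given by $e_*^a=1$ if $a\subseteq\mathrm{id}_X$ and $0$ otherwise (this is a monoid in $\mathbf{Mat}_{\mathbb R_0^+}$). A morphism $f\colon S\to I$ is a non-degenerate form on the monoid $(S,\nabla,e)$ if there is $\eta\colon I\to S\otimes S$ such that, with $\varepsilon=f\circ\nabla\colon S\otimes S\to I$, the snake identities hold: $\lambda_S\circ(\varepsilon\otimes\mathrm{id}_S)\circ(\mathrm{id}_S\otimes\eta)\circ\rho_S^{ -1}=\mathrm{id}_S$ and $\rho_S\circ(\mathrm{id}_S\otimes\varepsilon)\circ(\eta\otimes\mathrm{id}_S)\circ\lambda_S^{ -1}=\mathrm{id}_S$. -}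

module Defs where

open import Algebra.Bundles using (RawSemiring)
import Algebra.Definitions.RawMonoid as MonoidDefs
open import Data.Bool.Base using (Bool; T; _∧_; if_then_else_)
open import Data.Bool.Properties using (T?)
open import Data.Fin.Base using (Fin)
import Data.Fin.Properties as Fin
import Data.Fin.Subset as Subset
open import Data.Integer.Base using (+_)
open import Data.Nat.Base as ℕ using (ℕ; _⊔_)
import Data.Nat.Properties as ℕ
open import Data.Product.Base using (Σ; ∃; ∃₂; _×_; _,_; proj₁; proj₂; assocʳ′; assocˡ′)
open import Data.Product.Function.NonDependent.Propositional using (_×-↔_)
open import Data.Rational.Base as ℚ using (ℚ; 0ℚ; 1ℚ)
import Data.Rational.Properties as ℚ
open import Data.Rational.Solver using (module +-*-Solver)
open import Data.Sum.Base using (inj₁; inj₂)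
open import Data.Unit.Base using (⊤; tt)
open import Data.Vec.Base using (tabulate)
open import Function.Bundles using (_↔_; Inverse)
open import Function.Properties.Inverse using (↔-sym; ↔-trans; ↔⇒↣)
open import Level using (0ℓ)
open import Relation.Binary.Definitions using (DecidableEquality)
open import Relation.Binary.PropositionalEquality
  using (_≡_; refl; sym; trans; cong; subst)
open import Relation.Nullary.Decidable using (Dec; does; map′; _→-dec_)
open import Relation.Unary using (Pred; Decidable)

-- Cauchy reals with a modulus of convergence, compared by the setoid
-- equality _≈ℝ_ rather than by _≡_.

record ℝ : Set where
  constructor mkℝ
  field
    seq    : ℕ → ℚ
    cauchy : ∀ ε → 0ℚ ℚ.< ε →
             ∃ λ N → ∀ m n → N ℕ.≤ m → N ℕ.≤ n → ℚ.∣ seq m ℚ.- seq n ∣ ℚ.< ε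

open ℝ public

infix 4 _≈ℝ_ _<ℝ_ _≤ℝ_

_≈ℝ_ : ℝ → ℝ → Set
x ≈ℝ y = ∀ ε → 0ℚ ℚ.< ε →
         ∃ λ N → ∀ n → N ℕ.≤ n → ℚ.∣ seq x n ℚ.- seq y n ∣ ℚ.< ε

_<ℝ_ : ℝ → ℝ → Set
x <ℝ y = ∃ λ ε → 0ℚ ℚ.< ε ×
         ∃ λ N → ∀ n → N ℕ.≤ n → seq x n ℚ.+ ε ℚ.< seq y n

_≤ℝ_ : ℝ → ℝ → Set
x ≤ℝ y = ∀ ε → 0ℚ ℚ.< ε →
         ∃ λ N → ∀ n → N ℕ.≤ n → seq x n ℚ.< seq y n ℚ.+ ε

module Estimates where
  open ℚ.≤-Reasoning
  open +-*-Solver using (solve; con; _:+_; _:*_; _:-_; _:=_)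

  divide : ∀ ε B → 0ℚ ℚ.< ε → 0ℚ ℚ.< B → ∃ λ δ → 0ℚ ℚ.< δ × δ ℚ.* B ≡ ε
  divide ε B 0<ε 0<B = ε ℚ.* 1/B , δ>0 , eq
    where
    instance
      B>0 : ℚ.Positive B
      B>0 = ℚ.positive 0<B
      B≢0 : ℚ.NonZero B
      B≢0 = ℚ.pos⇒nonZero B
      ε>0 : ℚ.Positive ε
      ε>0 = ℚ.positive 0<ε
    1/B : ℚ
    1/B = ℚ.1/ B
    instance
      1/B>0 : ℚ.Positive 1/B
      1/B>0 = ℚ.1/pos⇒pos B
    δ>0 : 0ℚ ℚ.< ε ℚ.* 1/B
    δ>0 = ℚ.positive⁻¹ (ε ℚ.* 1/B) {{ℚ.pos*pos⇒pos ε 1/B}}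
    eq : ε ℚ.* 1/B ℚ.* B ≡ ε
    eq = trans (ℚ.*-assoc ε 1/B B)
         (trans (cong (ε ℚ.*_) (ℚ.*-inverseˡ B)) (ℚ.*-identityʳ ε))

  0<1 : 0ℚ ℚ.< 1ℚ
  0<1 = ℚ.positive⁻¹ 1ℚ

  +-pos : ∀ {p q} → 0ℚ ℚ.< p → 0ℚ ℚ.< q → 0ℚ ℚ.< p ℚ.+ q
  +-pos 0<p 0<q = ℚ.+-mono-< 0<p 0<q

  *-pos : ∀ {p q} → 0ℚ ℚ.< p → 0ℚ ℚ.< q → 0ℚ ℚ.< p ℚ.* q
  *-pos {p} {q} 0<p 0<q =
    ℚ.positive⁻¹ (p ℚ.* q) {{ℚ.pos*pos⇒pos p {{ℚ.positive 0<p}} q {{ℚ.positive 0<q}}}}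

  ⊓-pos : ∀ {p q} → 0ℚ ℚ.< p → 0ℚ ℚ.< q → 0ℚ ℚ.< p ℚ.⊓ q
  ⊓-pos {p} {q} 0<p 0<q with ℚ.⊓-sel p q
  ... | inj₁ eq = subst (0ℚ ℚ.<_) (sym eq) 0<p
  ... | inj₂ eq = subst (0ℚ ℚ.<_) (sym eq) 0<q

  p≤∣p∣ : ∀ p → p ℚ.≤ ℚ.∣ p ∣
  p≤∣p∣ p with ℚ.≤-total 0ℚ p
  ... | inj₁ 0≤p = ℚ.≤-reflexive (sym (ℚ.0≤p⇒∣p∣≡p 0≤p))
  ... | inj₂ p≤0 = ℚ.≤-trans p≤0 (ℚ.0≤∣p∣ p)

  half : ∀ ε → 0ℚ ℚ.< ε → ∃ λ δ → 0ℚ ℚ.< δ × δ ℚ.+ δ ≡ ε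
  half ε 0<ε =
    let δ , 0<δ , eq = divide ε (1ℚ ℚ.+ 1ℚ) 0<ε (+-pos 0<1 0<1)
    in δ , 0<δ , trans (solve 1 (λ d → d :+ d := d :* (con 1ℚ :+ con 1ℚ)) refl δ) eq

  *-mono-abs : ∀ p q {B δ} → ℚ.∣ p ∣ ℚ.< B → ℚ.∣ q ∣ ℚ.< δ →
               ℚ.∣ p ℚ.* q ∣ ℚ.≤ B ℚ.* δ
  *-mono-abs p q {B} {δ} p<B q<δ = begin
    ℚ.∣ p ℚ.* q ∣           ≡⟨ ℚ.∣p*q∣≡∣p∣*∣q∣ p q ⟩
    ℚ.∣ p ∣ ℚ.* ℚ.∣ q ∣     ≤⟨ ℚ.*-monoʳ-≤-nonNeg ℚ.∣ q ∣ {{ℚ.∣-∣-nonNeg q}} (ℚ.<⇒≤ p<B) ⟩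
    B ℚ.* ℚ.∣ q ∣           ≤⟨ ℚ.*-monoˡ-≤-nonNeg B {{B≥0}} (ℚ.<⇒≤ q<δ) ⟩
    B ℚ.* δ                 ∎
    where
    B≥0 : ℚ.NonNegative B
    B≥0 = ℚ.nonNegative (ℚ.≤-trans (ℚ.0≤∣p∣ p) (ℚ.<⇒≤ p<B))

  +-close : ∀ a b c d {δ} → ℚ.∣ a ℚ.- c ∣ ℚ.< δ → ℚ.∣ b ℚ.- d ∣ ℚ.< δ →
            ℚ.∣ (a ℚ.+ b) ℚ.- (c ℚ.+ d) ∣ ℚ.< δ ℚ.+ δ
  +-close a b c d {δ} a~c b~d = begin-strict
    ℚ.∣ (a ℚ.+ b) ℚ.- (c ℚ.+ d) ∣
      ≡⟨ cong ℚ.∣_∣ (solve 4 (λ a b c d → (a :+ b) :- (c :+ d) := (a :- c) :+ (b :- d)) refl a b c d) ⟩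
    ℚ.∣ (a ℚ.- c) ℚ.+ (b ℚ.- d) ∣
      ≤⟨ ℚ.∣p+q∣≤∣p∣+∣q∣ (a ℚ.- c) (b ℚ.- d) ⟩
    ℚ.∣ a ℚ.- c ∣ ℚ.+ ℚ.∣ b ℚ.- d ∣
      <⟨ ℚ.+-mono-< a~c b~d ⟩
    δ ℚ.+ δ ∎

  *-close : ∀ a b c d {A B δ} → ℚ.∣ a ∣ ℚ.< A → ℚ.∣ d ∣ ℚ.< B →
            ℚ.∣ a ℚ.- c ∣ ℚ.< δ → ℚ.∣ b ℚ.- d ∣ ℚ.< δ →
            ℚ.∣ a ℚ.* b ℚ.- c ℚ.* d ∣ ℚ.≤ δ ℚ.* (A ℚ.+ B)
  *-close a b c d {A} {B} {δ} a<A d<B a~c b~d = begin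
    ℚ.∣ a ℚ.* b ℚ.- c ℚ.* d ∣
      ≡⟨ cong ℚ.∣_∣ (solve 4 (λ a b c d → a :* b :- c :* d := a :* (b :- d) :+ d :* (a :- c)) refl a b c d) ⟩
    ℚ.∣ a ℚ.* (b ℚ.- d) ℚ.+ d ℚ.* (a ℚ.- c) ∣
      ≤⟨ ℚ.∣p+q∣≤∣p∣+∣q∣ (a ℚ.* (b ℚ.- d)) (d ℚ.* (a ℚ.- c)) ⟩
    ℚ.∣ a ℚ.* (b ℚ.- d) ∣ ℚ.+ ℚ.∣ d ℚ.* (a ℚ.- c) ∣
      ≤⟨ ℚ.+-mono-≤ (*-mono-abs a (b ℚ.- d) a<A b~d) (*-mono-abs d (a ℚ.- c) d<B a~c) ⟩
    A ℚ.* δ ℚ.+ B ℚ.* δ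
      ≡⟨ solve 3 (λ A B δ → A :* δ :+ B :* δ := δ :* (A :+ B)) refl A B δ ⟩
    δ ℚ.* (A ℚ.+ B) ∎

  +-nearly-pos : ∀ a b δ → 0ℚ ℚ.< a ℚ.+ δ → 0ℚ ℚ.< b ℚ.+ δ → 0ℚ ℚ.< a ℚ.+ b ℚ.+ (δ ℚ.+ δ)
  +-nearly-pos a b δ 0<a+δ 0<b+δ = begin-strict
    0ℚ                              <⟨ +-pos 0<a+δ 0<b+δ ⟩
    (a ℚ.+ δ) ℚ.+ (b ℚ.+ δ)         ≡⟨ solve 3 (λ a b d → (a :+ d) :+ (b :+ d) := a :+ b :+ (d :+ d)) refl a b δ ⟩
    a ℚ.+ b ℚ.+ (δ ℚ.+ δ)           ∎

  *-nearly-pos : ∀ a b δ {A B} → 0ℚ ℚ.< δ → ℚ.∣ a ∣ ℚ.< A → ℚ.∣ b ∣ ℚ.< B → δ ℚ.≤ 1ℚ →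
                 0ℚ ℚ.< a ℚ.+ δ → 0ℚ ℚ.< b ℚ.+ δ →
                 0ℚ ℚ.< a ℚ.* b ℚ.+ δ ℚ.* (A ℚ.+ B ℚ.+ 1ℚ)
  *-nearly-pos a b δ {A} {B} 0<δ a<A b<B δ≤1 0<a+δ 0<b+δ = begin-strict
    0ℚ
      <⟨ *-pos 0<a+δ 0<b+δ ⟩
    (a ℚ.+ δ) ℚ.* (b ℚ.+ δ)
      ≡⟨ solve 3 (λ a b d → (a :+ d) :* (b :+ d) := a :* b :+ d :* (a :+ b :+ d)) refl a b δ ⟩
    a ℚ.* b ℚ.+ δ ℚ.* (a ℚ.+ b ℚ.+ δ)
      ≤⟨ ℚ.+-monoʳ-≤ (a ℚ.* b) (ℚ.*-monoˡ-≤-nonNeg δ {{ℚ.nonNegative (ℚ.<⇒≤ 0<δ)}}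
           (ℚ.+-mono-≤ (ℚ.+-mono-≤ a≤A b≤B) δ≤1)) ⟩
    a ℚ.* b ℚ.+ δ ℚ.* (A ℚ.+ B ℚ.+ 1ℚ) ∎
    where
    a≤A : a ℚ.≤ A
    a≤A = ℚ.≤-trans (p≤∣p∣ a) (ℚ.<⇒≤ a<A)
    b≤B : b ℚ.≤ B
    b≤B = ℚ.≤-trans (p≤∣p∣ b) (ℚ.<⇒≤ b<B)

  ∣p∣<1+∣q∣ : ∀ p q → ℚ.∣ p ℚ.- q ∣ ℚ.< 1ℚ → ℚ.∣ p ∣ ℚ.< 1ℚ ℚ.+ ℚ.∣ q ∣
  ∣p∣<1+∣q∣ p q p~q = begin-strict
    ℚ.∣ p ∣                         ≡⟨ cong ℚ.∣_∣ (solve 2 (λ a b → a := (a :- b) :+ b) refl p q) ⟩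
    ℚ.∣ (p ℚ.- q) ℚ.+ q ∣           ≤⟨ ℚ.∣p+q∣≤∣p∣+∣q∣ (p ℚ.- q) q ⟩
    ℚ.∣ p ℚ.- q ∣ ℚ.+ ℚ.∣ q ∣       <⟨ ℚ.+-monoˡ-< ℚ.∣ q ∣ p~q ⟩
    1ℚ ℚ.+ ℚ.∣ q ∣                  ∎

  bound : ∀ x → ∃ λ B → 0ℚ ℚ.< B ×
          ∃ λ N → ∀ n → N ℕ.≤ n → ℚ.∣ seq x n ∣ ℚ.< B
  bound x = let N , close = cauchy x 1ℚ 0<1 in
    1ℚ ℚ.+ ℚ.∣ seq x N ∣ , ℚ.+-mono-<-≤ 0<1 (ℚ.0≤∣p∣ (seq x N)) ,
    N , λ n N≤n → ∣p∣<1+∣q∣ (seq x n) (seq x N) (close n N N≤n ℕ.≤-refl)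

  ≤ˡ : ∀ m n {o} → m ⊔ n ℕ.≤ o → m ℕ.≤ o
  ≤ˡ m n = ℕ.m⊔n≤o⇒m≤o m n

  ≤ʳ : ∀ m n {o} → m ⊔ n ℕ.≤ o → n ℕ.≤ o
  ≤ʳ m n = ℕ.m⊔n≤o⇒n≤o m n

  +-cauchy : ∀ x y ε → 0ℚ ℚ.< ε → ∃ λ N → ∀ m n → N ℕ.≤ m → N ℕ.≤ n →
             ℚ.∣ (seq x m ℚ.+ seq y m) ℚ.- (seq x n ℚ.+ seq y n) ∣ ℚ.< ε
  +-cauchy x y ε 0<ε =
    let δ , 0<δ , δ+δ≡ε = half ε 0<ε
        M , closeˣ = cauchy x δ 0<δ
        N , closeʸ = cauchy y δ 0<δ
    in M ⊔ N , λ m n ≤m ≤n → subst (_ ℚ.<_) δ+δ≡ε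
         (+-close (seq x m) (seq y m) (seq x n) (seq y n)
           (closeˣ m n (≤ˡ M N ≤m) (≤ˡ M N ≤n)) (closeʸ m n (≤ʳ M N ≤m) (≤ʳ M N ≤n)))

  *-cauchy : ∀ x y ε → 0ℚ ℚ.< ε → ∃ λ N → ∀ m n → N ℕ.≤ m → N ℕ.≤ n →
             ℚ.∣ seq x m ℚ.* seq y m ℚ.- seq x n ℚ.* seq y n ∣ ℚ.< ε
  *-cauchy x y ε 0<ε =
    let A , 0<A , K , x<A = bound x
        B , 0<B , L , y<B = bound y
        θ , 0<θ , θ+θ≡ε = half ε 0<ε
        δ , 0<δ , δ*[A+B]≡θ = divide θ (A ℚ.+ B) 0<θ (+-pos 0<A 0<B)
        M , closeˣ = cauchy x δ 0<δ
        N , closeʸ = cauchy y δ 0<δ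
        θ<ε = subst (θ ℚ.<_) θ+θ≡ε (subst (ℚ._< θ ℚ.+ θ) (ℚ.+-identityʳ θ) (ℚ.+-monoʳ-< θ 0<θ))
    in (K ⊔ L) ⊔ (M ⊔ N) , λ m n ≤m ≤n → ℚ.≤-<-trans
         (subst (_ ℚ.≤_) δ*[A+B]≡θ
           (*-close (seq x m) (seq y m) (seq x n) (seq y n)
             (x<A m (≤ˡ K L (≤ˡ (K ⊔ L) (M ⊔ N) ≤m)))
             (y<B n (≤ʳ K L (≤ˡ (K ⊔ L) (M ⊔ N) ≤n)))
             (closeˣ m n (≤ˡ M N (≤ʳ (K ⊔ L) (M ⊔ N) ≤m)) (≤ˡ M N (≤ʳ (K ⊔ L) (M ⊔ N) ≤n)))
             (closeʸ m n (≤ʳ M N (≤ʳ (K ⊔ L) (M ⊔ N) ≤m)) (≤ʳ M N (≤ʳ (K ⊔ L) (M ⊔ N) ≤n)))))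
         θ<ε

open Estimates

fromℚ : ℚ → ℝ
fromℚ q = mkℝ (λ _ → q) λ ε 0<ε → 0 , λ _ _ _ _ →
  subst (ℚ._< ε) (sym (cong ℚ.∣_∣ (ℚ.+-inverseʳ q))) 0<ε

infixl 6 _+ℝ_
infixl 7 _*ℝ_

_+ℝ_ : ℝ → ℝ → ℝ
x +ℝ y = mkℝ (λ n → seq x n ℚ.+ seq y n) (+-cauchy x y)

_*ℝ_ : ℝ → ℝ → ℝ
x *ℝ y = mkℝ (λ n → seq x n ℚ.* seq y n) (*-cauchy x y)

0ℝ : ℝ
0ℝ = fromℚ 0ℚ

fromℚ-nonNeg : ∀ {q} → 0ℚ ℚ.≤ q → 0ℝ ≤ℝ fromℚ q
fromℚ-nonNeg {q} 0≤q ε 0<ε = 0 , λ _ _ → ℚ.+-mono-≤-< 0≤q 0<ε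

+ℝ-nonNeg : ∀ {x y} → 0ℝ ≤ℝ x → 0ℝ ≤ℝ y → 0ℝ ≤ℝ x +ℝ y
+ℝ-nonNeg {x} {y} 0≤x 0≤y ε 0<ε =
  let δ , 0<δ , δ+δ≡ε = half ε 0<ε
      M , posˣ = 0≤x δ 0<δ
      N , posʸ = 0≤y δ 0<δ
  in M ⊔ N , λ n ≤n → subst (λ t → 0ℚ ℚ.< seq x n ℚ.+ seq y n ℚ.+ t) δ+δ≡ε
       (+-nearly-pos (seq x n) (seq y n) δ (posˣ n (≤ˡ M N ≤n)) (posʸ n (≤ʳ M N ≤n)))

*ℝ-nonNeg : ∀ {x y} → 0ℝ ≤ℝ x → 0ℝ ≤ℝ y → 0ℝ ≤ℝ x *ℝ y
*ℝ-nonNeg {x} {y} 0≤x 0≤y ε 0<ε =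
  let A , 0<A , K , x<A = bound x
      B , 0<B , L , y<B = bound y
      C = A ℚ.+ B ℚ.+ 1ℚ
      0<C = +-pos (+-pos 0<A 0<B) 0<1
      θ , 0<θ , θ*C≡ε = divide ε C 0<ε 0<C
      δ = θ ℚ.⊓ 1ℚ
      0<δ = ⊓-pos 0<θ 0<1
      δ*C≤ε = subst (δ ℚ.* C ℚ.≤_) θ*C≡ε
        (ℚ.*-monoʳ-≤-nonNeg C {{ℚ.nonNegative (ℚ.<⇒≤ 0<C)}} (ℚ.p⊓q≤p θ 1ℚ))
      M , posˣ = 0≤x δ 0<δ
      N , posʸ = 0≤y δ 0<δ
  in (K ⊔ L) ⊔ (M ⊔ N) , λ n ≤n → ℚ.<-≤-trans
       (*-nearly-pos (seq x n) (seq y n) δ 0<δ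
         (x<A n (≤ˡ K L (≤ˡ (K ⊔ L) (M ⊔ N) ≤n)))
         (y<B n (≤ʳ K L (≤ˡ (K ⊔ L) (M ⊔ N) ≤n)))
         (ℚ.p⊓q≤q θ 1ℚ)
         (posˣ n (≤ˡ M N (≤ʳ (K ⊔ L) (M ⊔ N) ≤n)))
         (posʸ n (≤ʳ M N (≤ʳ (K ⊔ L) (M ⊔ N) ≤n))))
       (ℚ.+-monoʳ-≤ (seq x n ℚ.* seq y n) δ*C≤ε)

record ℝ≥0 : Set where
  constructor mkℝ≥0
  field
    value  : ℝ
    nonNeg : 0ℝ ≤ℝ value

open ℝ≥0 public

infix  4 _≈_ _<_
infixl 6 _+_
infixl 7 _*_

_≈_ : ℝ≥0 → ℝ≥0 → Set
x ≈ y = value x ≈ℝ value y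

_<_ : ℝ≥0 → ℝ≥0 → Set
x < y = value x <ℝ value y

_+_ : ℝ≥0 → ℝ≥0 → ℝ≥0
x + y = mkℝ≥0 (value x +ℝ value y) (+ℝ-nonNeg {value x} {value y} (nonNeg x) (nonNeg y))

_*_ : ℝ≥0 → ℝ≥0 → ℝ≥0
x * y = mkℝ≥0 (value x *ℝ value y) (*ℝ-nonNeg {value x} {value y} (nonNeg x) (nonNeg y))

fromℕ : ℕ → ℝ≥0
fromℕ n = mkℝ≥0 (fromℚ n/1) (fromℚ-nonNeg (ℚ.nonNegative⁻¹ n/1 {{ℚ.normalize-nonNeg n 1}}))
  where
  n/1 : ℚ
  n/1 = + n ℚ./ 1

0# 1# : ℝ≥0
0# = fromℕ 0
1# = fromℕ 1

ℝ≥0-rawSemiring : RawSemiring 0ℓ 0ℓ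
ℝ≥0-rawSemiring = record
  { Carrier = ℝ≥0 ; _≈_ = _≈_ ; _+_ = _+_ ; _*_ = _*_ ; 0# = 0# ; 1# = 1# }

open MonoidDefs (RawSemiring.+-rawMonoid ℝ≥0-rawSemiring) using (sum)

indicator : Bool → ℝ≥0
indicator b = if b then 1# else 0#

-- The enumeration is used only to form sums, to count, and to decide
-- equality and universal quantification, so its choice is immaterial.

record FinSet : Set₁ where
  field
    Carrier     : Set
    size        : ℕ
    enumeration : Fin size ↔ Carrier

  element : Fin size → Carrier
  element = Inverse.to enumeration

  infix 4 _≟_
  _≟_ : DecidableEquality Carrier
  _≟_ = Fin.inj⇒≟ (↔⇒↣ (↔-sym enumeration))

  ∀? : {P : Pred Carrier 0ℓ} → Decidable P → Dec (∀ x → P x)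
  ∀? {P} P? = map′
    (λ all x → subst P (Inverse.strictlyInverseˡ enumeration x) (all (Inverse.from enumeration x)))
    (λ all i → all (element i))
    (Fin.all? (λ i → P? (element i)))

  ∑ : (Carrier → ℝ≥0) → ℝ≥0
  ∑ g = sum (λ i → g (element i))

  count : (Carrier → Bool) → ℕ
  count p = Subset.∣ tabulate (λ i → p (element i)) ∣

∣_∣ : FinSet → Set
∣_∣ = FinSet.Carrier

infixr 7 _⊗_

_⊗_ : FinSet → FinSet → FinSet
X ⊗ Y = record
  { Carrier     = ∣ X ∣ × ∣ Y ∣
  ; size        = FinSet.size X ℕ.* FinSet.size Y
  ; enumeration = ↔-trans Fin.*↔× (FinSet.enumeration X ×-↔ FinSet.enumeration Y)
  }

I : FinSet
I = record { Carrier = ⊤ ; size = 1 ; enumeration = Fin.1↔⊤ }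

-- entry f x y is f_x^y: the first index is the source.

infix  4 _≋_
infixr 9 _∘ᴹ_
infixr 7 _⊗ᴹ_

record Mat (X Y : FinSet) : Set where
  constructor mkMat
  field
    entry : ∣ X ∣ → ∣ Y ∣ → ℝ≥0

open Mat public

_≋_ : ∀ {X Y} → Mat X Y → Mat X Y → Set
f ≋ g = ∀ x y → entry f x y ≈ entry g x y

-- The structural isomorphisms below are the matrices of the corresponding
-- bijections of finite sets.
graph : ∀ {X Y} → (∣ X ∣ → ∣ Y ∣) → Mat X Y
graph {Y = Y} h = mkMat λ x y → indicator (does (FinSet._≟_ Y (h x) y))

idᴹ : ∀ {X} → Mat X X
idᴹ = graph (λ x → x)

_∘ᴹ_ : ∀ {X Y Z} → Mat Y Z → Mat X Y → Mat X Z
_∘ᴹ_ {Y = Y} g f = mkMat λ a c → FinSet.∑ Y (λ b → entry f a b * entry g b c)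

_⊗ᴹ_ : ∀ {A B C D} → Mat A B → Mat C D → Mat (A ⊗ C) (B ⊗ D)
f ⊗ᴹ g = mkMat λ (a , c) (b , d) → entry f a b * entry g c d

λ⇒ : ∀ {A} → Mat (I ⊗ A) A
λ⇒ = graph proj₂

λ⇐ : ∀ {A} → Mat A (I ⊗ A)
λ⇐ = graph (tt ,_)

ρ⇒ : ∀ {A} → Mat (A ⊗ I) A
ρ⇒ = graph proj₁

ρ⇐ : ∀ {A} → Mat A (A ⊗ I)
ρ⇐ = graph (_, tt)

α⇒ : ∀ {A B C} → Mat ((A ⊗ B) ⊗ C) (A ⊗ (B ⊗ C))
α⇒ = graph assocʳ′

α⇐ : ∀ {A B C} → Mat (A ⊗ (B ⊗ C)) ((A ⊗ B) ⊗ C)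
α⇐ = graph assocˡ′

-- The data of a monoid object.  The monoid laws play no role in the notion
-- of a non-degenerate form.
record RawMonoidObject : Set₁ where
  field
    object : FinSet
    mult   : Mat (object ⊗ object) object
    unit   : Mat I object

-- The associators, left implicit in the usual notation for the snake
-- identities, are inserted.
IsNonDegenerateForm : (M : RawMonoidObject) → Mat (RawMonoidObject.object M) I → Set
IsNonDegenerateForm M f = Σ (Mat I (S ⊗ S)) λ η →
  (λ⇒ {S} ∘ᴹ (ε ⊗ᴹ idᴹ {S}) ∘ᴹ α⇐ {S} {S} {S} ∘ᴹ (idᴹ {S} ⊗ᴹ η) ∘ᴹ ρ⇐ {S} ≋ idᴹ {S}) ×
  (ρ⇒ {S} ∘ᴹ (idᴹ {S} ⊗ᴹ ε) ∘ᴹ α⇒ {S} {S} {S} ∘ᴹ (η ⊗ᴹ idᴹ {S}) ∘ᴹ λ⇐ {S} ≋ idᴹ {S})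
  where
  S : FinSet
  S = RawMonoidObject.object M
  ε : Mat (S ⊗ S) I
  ε = f ∘ᴹ RawMonoidObject.mult M

-- A set S of subsets of X × X, given as a finite family of characteristic
-- functions in which distinct indices name distinct subsets.  As S is finite
-- and its members are subsets of a finite set, Boolean membership loses
-- nothing classically.
record SubsetFamily (X : FinSet) : Set₁ where
  field
    S        : FinSet
    member   : ∣ S ∣ → ∣ X ∣ → ∣ X ∣ → Bool
    distinct : ∀ {a b} → (∀ x y → member a x y ≡ member b x y) → a ≡ b

  infix 4 _,_∈_
  _,_∈_ : ∣ X ∣ → ∣ X ∣ → ∣ S ∣ → Set
  x , y ∈ a = T (member a x y)

  _⊆id : ∣ S ∣ → Set
  a ⊆id = ∀ x y → x , y ∈ a → x ≡ y

  _⊆id? : Decidable _⊆id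
  a ⊆id? = ∀? X (λ x → ∀? X (λ y → T? (member a x y) →-dec FinSet._≟_ X x y))
    where open FinSet using (∀?)

  paths : ∣ S ∣ → ∣ S ∣ → ∣ X ∣ → ∣ X ∣ → ℕ
  paths a b x y = FinSet.count X (λ z → member a x z ∧ member b z y)

module _ {X : FinSet} (𝒮 : SubsetFamily X) where
  open SubsetFamily 𝒮

  record CC1 : Set where
    field
      nonempty : ∀ a → ∃₂ λ x y → x , y ∈ a
      disjoint : ∀ {a b x y} → x , y ∈ a → x , y ∈ b → a ≡ b
      covering : ∀ x y → ∃ λ a → x , y ∈ a

  CC2 : Set
  CC2 = ∀ p → (∃ λ x → x , x ∈ p) → p ⊆id

  CC3 : Set
  CC3 = ∀ a b c {x y x′ y′} → x , y ∈ c → x′ , y′ ∈ c → paths a b x y ≡ paths a b x′ y′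

  CC4 : Set
  CC4 = ∀ c → ∃ λ d → ∀ x y → member d y x ≡ member c x y

  record IsCoherentConfiguration : Set where
    field
      cc1 : CC1
      cc2 : CC2
      cc3 : CC3
      cc4 : CC4

  -- ∇ a b c counts at the pair in c supplied by the partition; under CC3 any
  -- other pair in c gives the same number.
  ∇ : CC1 → ∣ S ∣ → ∣ S ∣ → ∣ S ∣ → ℕ
  ∇ cc1 a b c = let x , y , _ = CC1.nonempty cc1 c in paths a b x y

  ∇-independent : (cc1 : CC1) → CC3 → ∀ a b c {x y} → x , y ∈ c → paths a b x y ≡ ∇ cc1 a b c
  ∇-independent cc1 cc3 a b c xy∈c = cc3 a b c xy∈c (proj₂ (proj₂ (CC1.nonempty cc1 c)))

  associatedMonoid : CC1 → RawMonoidObject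
  associatedMonoid cc1 = record
    { object = S
    ; mult   = mkMat λ (a , b) c → fromℕ (∇ cc1 a b c)
    ; unit   = mkMat λ _ a → indicator (does (a ⊆id?))
    }

{-# OPTIONS --safe #-}

-- Let E a b = Σ_c ∇_{ab}^c f_c be the pairing of the form.  Since f is positive
-- exactly on the classes inside the diagonal, E a b > 0 if and only if some
-- (x , y) ∈ a has (y , x) ∈ b.  Non-degeneracy says that E has a non-negative
-- two-sided inverse, which forces each row of E to have a single positive entry:
-- all opposites of pairs in a lie in one class b, and, by the same argument for b,
-- this b is the inverse relation of a.  Conversely, if S is closed under inverses
-- then E is a monomial matrix with positive entries at (a , a⁻¹), hence invertible.

module Submission where

open import Defs
open import Algebra.Bundles using (CommutativeMonoid)
import Algebra.Properties.CommutativeMonoid.Sum as Sum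
open import Algebra.Structures.Biased using (isCommutativeMonoidˡ)
open import Data.Bool.Base using (Bool; T; _∧_)
open import Data.Bool.Properties using (T-≡; T-∧; ⇔→≡)
open import Data.Fin.Base using (Fin; zero; suc; punchIn)
open import Data.Fin.Properties using (punchInᵢ≢i)
import Data.Fin.Subset as Subset
import Data.Fin.Subset.Properties as Subset
open import Data.Nat.Base as ℕ using (ℕ; zero; suc; _⊔_)
import Data.Nat.Properties as ℕ
open import Data.Product.Base
  using (∃; _×_; _,_; proj₁; proj₂; assocʳ′; assocˡ′)
open import Data.Rational.Base as ℚ using (ℚ; 0ℚ; 1ℚ)
import Data.Rational.Properties as ℚ
open import Data.Rational.Solver using (module +-*-Solver)
open import Data.Sum.Base using (_⊎_; inj₁; inj₂; [_,_]′)
open import Data.Unit.Base using (tt)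
open import Data.Vec.Base using (tabulate)
open import Data.Vec.Properties using (lookup∘tabulate; []=⇒lookup; lookup⇒[]=)
open import Function.Base using (_∘_; case_of_)
open import Function.Bundles using (_⇔_; mk⇔; Equivalence; Inverse)
open import Level using (0ℓ)
open import Relation.Binary.Bundles using (Setoid)
open import Relation.Binary.PropositionalEquality
  using (_≡_; _≢_; refl; sym; trans; cong; cong₂; subst; ≢-sym; _≗_)
import Relation.Binary.Reasoning.Setoid as SetoidReasoning
open import Relation.Nullary.Decidable using (Dec; yes; no; dec-true; dec-false; decidable-stable)
open import Relation.Nullary.Negation using (¬_)

open Estimates
open +-*-Solver using (solve; con; _:+_; _:*_; _:-_; :-_; _:=_)

-- Inequalities between rationals

p<ε∧0<p+ε⇒∣p∣<ε : ∀ p {ε} → p ℚ.< ε → 0ℚ ℚ.< p ℚ.+ ε → ℚ.∣ p ∣ ℚ.< ε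
p<ε∧0<p+ε⇒∣p∣<ε p {ε} p<ε 0<p+ε with ℚ.∣p∣≡p∨∣p∣≡-p p
... | inj₁ eq = subst (ℚ._< ε) (sym eq) p<ε
... | inj₂ eq = begin-strict
  ℚ.∣ p ∣                    ≡⟨ eq ⟩
  ℚ.- p                      ≡⟨ ℚ.+-identityʳ (ℚ.- p) ⟨
  ℚ.- p ℚ.+ 0ℚ               <⟨ ℚ.+-monoʳ-< (ℚ.- p) 0<p+ε ⟩
  ℚ.- p ℚ.+ (p ℚ.+ ε)        ≡⟨ solve 2 (λ p e → (:- p) :+ (p :+ e) := e) refl p ε ⟩
  ε                          ∎
  where open ℚ.≤-Reasoning

∣p-q∣<δ⇒p<q+δ : ∀ p q {δ} → ℚ.∣ p ℚ.- q ∣ ℚ.< δ → p ℚ.< q ℚ.+ δ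
∣p-q∣<δ⇒p<q+δ p q {δ} close = begin-strict
  p                          ≡⟨ solve 2 (λ p q → p := q :+ (p :- q)) refl p q ⟩
  q ℚ.+ (p ℚ.- q)            ≤⟨ ℚ.+-monoʳ-≤ q (p≤∣p∣ (p ℚ.- q)) ⟩
  q ℚ.+ ℚ.∣ p ℚ.- q ∣        <⟨ ℚ.+-monoʳ-< q close ⟩
  q ℚ.+ δ                    ∎
  where open ℚ.≤-Reasoning

∣p-q∣≡∣q-p∣ : ∀ p q → ℚ.∣ p ℚ.- q ∣ ≡ ℚ.∣ q ℚ.- p ∣
∣p-q∣≡∣q-p∣ p q = trans (cong ℚ.∣_∣ (solve 2 (λ p q → p :- q := :- (q :- p)) refl p q))
  (ℚ.∣-p∣≡∣p∣ (q ℚ.- p))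

+-cancelʳ-< : ∀ r {p q} → p ℚ.+ r ℚ.< q ℚ.+ r → p ℚ.< q
+-cancelʳ-< r {p} {q} lt = ℚ.≰⇒> λ q≤p →
  ℚ.<-irrefl refl (ℚ.<-≤-trans lt (ℚ.+-monoˡ-≤ r q≤p))

<-half : ∀ {δ ε} → 0ℚ ℚ.< δ → δ ℚ.+ δ ≡ ε → δ ℚ.< ε
<-half {δ} 0<δ refl = subst (ℚ._< δ ℚ.+ δ) (ℚ.+-identityʳ δ) (ℚ.+-monoʳ-< δ 0<δ)

-- Equality of Cauchy reals as a congruence

≗⇒≈ℝ : ∀ x y → (∀ n → seq x n ≡ seq y n) → x ≈ℝ y
≗⇒≈ℝ x y eq ε 0<ε = 0 , λ n _ → subst (ℚ._< ε)
  (sym (cong ℚ.∣_∣ (trans (cong (ℚ._- seq y n) (eq n)) (ℚ.+-inverseʳ (seq y n))))) 0<ε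

≈ℝ-sym : ∀ x y → x ≈ℝ y → y ≈ℝ x
≈ℝ-sym x y x≈y ε 0<ε = let N , close = x≈y ε 0<ε in
  N , λ n N≤n → subst (ℚ._< ε) (∣p-q∣≡∣q-p∣ (seq x n) (seq y n)) (close n N≤n)

≈ℝ-trans : ∀ x y z → x ≈ℝ y → y ≈ℝ z → x ≈ℝ z
≈ℝ-trans x y z x≈y y≈z ε 0<ε =
  let δ , 0<δ , δ+δ≡ε = half ε 0<ε
      M , x~y = x≈y δ 0<δ
      N , y~z = y≈z δ 0<δ
  in M ⊔ N , λ n ≤n → subst (_ ℚ.<_) δ+δ≡ε (ℚ.≤-<-trans
       (ℚ.≤-trans
         (ℚ.≤-reflexive (cong ℚ.∣_∣
           (solve 3 (λ a b c → a :- c := (a :- b) :+ (b :- c)) refl (seq x n) (seq y n) (seq z n))))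
         (ℚ.∣p+q∣≤∣p∣+∣q∣ (seq x n ℚ.- seq y n) (seq y n ℚ.- seq z n)))
       (ℚ.+-mono-< (x~y n (≤ˡ M N ≤n)) (y~z n (≤ʳ M N ≤n))))

+ℝ-cong : ∀ x y u v → x ≈ℝ y → u ≈ℝ v → x +ℝ u ≈ℝ y +ℝ v
+ℝ-cong x y u v x≈y u≈v ε 0<ε =
  let δ , 0<δ , δ+δ≡ε = half ε 0<ε
      M , x~y = x≈y δ 0<δ
      N , u~v = u≈v δ 0<δ
  in M ⊔ N , λ n ≤n → subst (_ ℚ.<_) δ+δ≡ε
       (+-close (seq x n) (seq u n) (seq y n) (seq v n) (x~y n (≤ˡ M N ≤n)) (u~v n (≤ʳ M N ≤n)))

*ℝ-cong : ∀ x y u v → x ≈ℝ y → u ≈ℝ v → x *ℝ u ≈ℝ y *ℝ v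
*ℝ-cong x y u v x≈y u≈v ε 0<ε =
  let A , 0<A , K , x<A = bound x
      B , 0<B , L , v<B = bound v
      θ , 0<θ , θ+θ≡ε = half ε 0<ε
      δ , 0<δ , δ*[A+B]≡θ = divide θ (A ℚ.+ B) 0<θ (+-pos 0<A 0<B)
      M , x~y = x≈y δ 0<δ
      N , u~v = u≈v δ 0<δ
  in (K ⊔ L) ⊔ (M ⊔ N) , λ n ≤n → ℚ.≤-<-trans
       (subst (_ ℚ.≤_) δ*[A+B]≡θ
         (*-close (seq x n) (seq u n) (seq y n) (seq v n)
           (x<A n (≤ˡ K L (≤ˡ (K ⊔ L) (M ⊔ N) ≤n)))
           (v<B n (≤ʳ K L (≤ˡ (K ⊔ L) (M ⊔ N) ≤n)))
           (x~y n (≤ˡ M N (≤ʳ (K ⊔ L) (M ⊔ N) ≤n)))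
           (u~v n (≤ʳ M N (≤ʳ (K ⊔ L) (M ⊔ N) ≤n)))))
       (<-half 0<θ θ+θ≡ε)

-- Algebra of the non-negative reals

-- Wrapping _≈_ and positivity in records keeps the operands inferable: both
-- relations unfold to statements about the underlying sequences.
infix 4 _≃_

record _≃_ (x y : ℝ≥0) : Set where
  constructor wrap
  field
    unwrap : x ≈ y

open _≃_ public

record Positive (x : ℝ≥0) : Set where
  constructor wrap⁺
  field
    unwrap⁺ : 0# < x

open Positive public

≃-setoid : Setoid 0ℓ 0ℓ
≃-setoid = record
  { Carrier = ℝ≥0
  ; _≈_ = _≃_
  ; isEquivalence = record
    { refl  = λ {x} → wrap (≗⇒≈ℝ (value x) (value x) λ _ → refl)
    ; sym   = λ {x y} x≃y → wrap (≈ℝ-sym (value x) (value y) (unwrap x≃y))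
    ; trans = λ {x y z} x≃y y≃z →
        wrap (≈ℝ-trans (value x) (value y) (value z) (unwrap x≃y) (unwrap y≃z))
    }
  }

module ≃ = Setoid ≃-setoid
module ≃-Reasoning = SetoidReasoning ≃-setoid

≗⇒≃ : ∀ x y → (∀ n → seq (value x) n ≡ seq (value y) n) → x ≃ y
≗⇒≃ x y eq = wrap (≗⇒≈ℝ (value x) (value y) eq)

+-0-commutativeMonoid : CommutativeMonoid 0ℓ 0ℓ
+-0-commutativeMonoid = record
  { Carrier = ℝ≥0
  ; _≈_ = _≃_
  ; _∙_ = _+_
  ; ε = 0#
  ; isCommutativeMonoid = isCommutativeMonoidˡ record
    { isSemigroup = record
      { isMagma = record
        { isEquivalence = ≃.isEquivalence
        ; ∙-cong = λ {x y u v} x≃y u≃v →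
            wrap (+ℝ-cong (value x) (value y) (value u) (value v) (unwrap x≃y) (unwrap u≃v))
        }
      ; assoc = λ x y z → ≗⇒≃ (x + y + z) (x + (y + z))
          λ n → ℚ.+-assoc (seq (value x) n) (seq (value y) n) (seq (value z) n)
      }
    ; identityˡ = λ x → ≗⇒≃ (0# + x) x λ n → ℚ.+-identityˡ (seq (value x) n)
    ; comm = λ x y → ≗⇒≃ (x + y) (y + x) λ n → ℚ.+-comm (seq (value x) n) (seq (value y) n)
    }
  }

*-cong : ∀ x y u v → x ≃ y → u ≃ v → x * u ≃ y * v
*-cong x y u v x≃y u≃v =
  wrap (*ℝ-cong (value x) (value y) (value u) (value v) (unwrap x≃y) (unwrap u≃v))

*-comm : ∀ x y → x * y ≃ y * x
*-comm x y = ≗⇒≃ (x * y) (y * x) λ n → ℚ.*-comm (seq (value x) n) (seq (value y) n)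

*-identityˡ : ∀ x → 1# * x ≃ x
*-identityˡ x = ≗⇒≃ (1# * x) x λ n → ℚ.*-identityˡ (seq (value x) n)

*-identityʳ : ∀ x → x * 1# ≃ x
*-identityʳ x = ≗⇒≃ (x * 1#) x λ n → ℚ.*-identityʳ (seq (value x) n)

*-unitˡ : ∀ x y → x ≡ 1# → x * y ≃ y
*-unitˡ x y refl = *-identityˡ y

*-unitʳ : ∀ x y → y ≡ 1# → x * y ≃ x
*-unitʳ x y refl = *-identityʳ x

*-zeroˡ : ∀ x y → x ≃ 0# → x * y ≃ 0#
*-zeroˡ x y x≃0 = begin
  x * y    ≈⟨ *-cong x 0# y y x≃0 ≃.refl ⟩
  0# * y   ≈⟨ ≗⇒≃ (0# * y) 0# (λ n → ℚ.*-zeroˡ (seq (value y) n)) ⟩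
  0#       ∎
  where open ≃-Reasoning

*-zeroʳ : ∀ x y → y ≃ 0# → x * y ≃ 0#
*-zeroʳ x y y≃0 = ≃.trans (*-comm x y) (*-zeroˡ y x y≃0)

-- Positivity and vanishing

EventuallyAbove : ℚ → ℝ≥0 → Set
EventuallyAbove ε x = ∃ λ N → ∀ n → N ℕ.≤ n → ε ℚ.< seq (value x) n

positive⇒above : ∀ {x} → Positive x → ∃ λ ε → 0ℚ ℚ.< ε × EventuallyAbove ε x
positive⇒above {x} (wrap⁺ (ε , 0<ε , N , above)) = ε , 0<ε , N , λ n N≤n →
  subst (ℚ._< seq (value x) n) (ℚ.+-identityˡ ε) (above n N≤n)

above⇒positive : ∀ {x ε} → 0ℚ ℚ.< ε → EventuallyAbove ε x → Positive x
above⇒positive {x} {ε} 0<ε (N , above) = wrap⁺ (ε , 0<ε , N , λ n N≤n →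
  subst (ℚ._< seq (value x) n) (sym (ℚ.+-identityˡ ε)) (above n N≤n))

positive-resp-≃ : ∀ {x y} → x ≃ y → Positive x → Positive y
positive-resp-≃ {x} {y} x≃y x>0 =
  let ε , 0<ε , M , above = positive⇒above x>0
      δ , 0<δ , δ+δ≡ε = half ε 0<ε
      N , close = unwrap x≃y δ 0<δ
  in above⇒positive 0<δ (M ⊔ N , λ n ≤n → +-cancelʳ-< δ (ℚ.<-trans
       (subst (ℚ._< seq (value x) n) (sym δ+δ≡ε) (above n (≤ˡ M N ≤n)))
       (∣p-q∣<δ⇒p<q+δ (seq (value x) n) (seq (value y) n) (close n (≤ʳ M N ≤n)))))

≃0⇒¬positive : ∀ {x} → x ≃ 0# → ¬ Positive x
≃0⇒¬positive x≃0 x>0 =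
  let ε , 0<ε , N , above = positive⇒above (positive-resp-≃ x≃0 x>0)
  in ℚ.<-asym 0<ε (above N ℕ.≤-refl)

-- A non-negative real may have negative terms, but those of `y` eventually exceed `- δ`. Half of
-- the lower bound `ε` for `x` absorbs them and the other half remains.
+-positive : ∀ x y → Positive x → Positive (x + y)
+-positive x y x>0 =
  let ε , 0<ε , M , above = positive⇒above x>0
      δ , 0<δ , δ+δ≡ε = half ε 0<ε
      N , y>-δ = nonNeg y δ 0<δ
  in above⇒positive 0<δ (M ⊔ N , λ n ≤n → +-cancelʳ-< δ
       (subst (δ ℚ.+ δ ℚ.<_) (sym (ℚ.+-assoc (seq (value x) n) (seq (value y) n) δ))
         (subst (ℚ._< seq (value x) n ℚ.+ (seq (value y) n ℚ.+ δ))
           (trans (ℚ.+-identityʳ ε) (sym δ+δ≡ε))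
           (ℚ.+-mono-< (above n (≤ˡ M N ≤n)) (y>-δ n (≤ʳ M N ≤n))))))

*-positive : ∀ x y → Positive x → Positive y → Positive (x * y)
*-positive x y x>0 y>0 =
  let δ , 0<δ , M , x>δ = positive⇒above x>0
      ε , 0<ε , N , y>ε = positive⇒above y>0
  in above⇒positive (*-pos 0<δ 0<ε) (M ⊔ N , λ n ≤n → ℚ.<-trans
       (ℚ.*-monoʳ-<-pos δ {{ℚ.positive 0<δ}} (y>ε n (≤ʳ M N ≤n)))
       (ℚ.*-monoˡ-<-pos (seq (value y) n)
         {{ℚ.positive (ℚ.<-trans 0<ε (y>ε n (≤ʳ M N ≤n)))}} (x>δ n (≤ˡ M N ≤n))))

fromℕ-positive : ∀ {n} → 0 ℕ.< n → Positive (fromℕ n)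
fromℕ-positive {n} 0<n =
  let 0<n/1 = ℚ.positive⁻¹ _ {{ℚ.normalize-pos n 1 {{_}} {{ℕ.>-nonZero 0<n}}}}
      δ , 0<δ , δ+δ≡n/1 = half _ 0<n/1
  -- The sequence is constant and the bound must be strict, hence half the value.
  in above⇒positive 0<δ (0 , λ _ _ → <-half 0<δ δ+δ≡n/1)

1#-positive : Positive 1#
1#-positive = fromℕ-positive {1} (ℕ.s≤s ℕ.z≤n)

-- Take `δ = ε / 3` and `M` beyond which terms differ by less than `δ`. If `s M` exceeded `2δ`, all
-- later terms would exceed `δ` and `x` would be positive. So `s M ≤ 2δ`, and later terms stay below
-- `3δ = ε`. Constructively this is how a refutation of positivity becomes an equation.
¬positive⇒≃0 : ∀ {x} → ¬ Positive x → x ≃ 0#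
¬positive⇒≃0 {x} x≯0 = wrap λ ε 0<ε →
  let δ , 0<δ , δ*3≡ε = divide ε (1ℚ ℚ.+ 1ℚ ℚ.+ 1ℚ) 0<ε (+-pos (+-pos 0<1 0<1) 0<1)
      3δ≡ε = trans (solve 1 (λ d → d :+ d :+ d := d :* (con 1ℚ :+ con 1ℚ :+ con 1ℚ)) refl δ) δ*3≡ε
      M , close = cauchy (value x) δ 0<δ
      N , s>-ε = nonNeg x ε 0<ε
      sM≤2δ : s M ℚ.≤ δ ℚ.+ δ
      sM≤2δ = ℚ.≮⇒≥ λ 2δ<sM → x≯0 (above⇒positive 0<δ (M , λ n M≤n → +-cancelʳ-< δ
        (ℚ.<-trans 2δ<sM (∣p-q∣<δ⇒p<q+δ (s M) (s n) (close M n ℕ.≤-refl M≤n)))))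
  in M ⊔ N , λ n ≤n → subst (λ t → ℚ.∣ t ∣ ℚ.< ε) (sym (ℚ.+-identityʳ (s n)))
       (p<ε∧0<p+ε⇒∣p∣<ε (s n)
         (subst (s n ℚ.<_) 3δ≡ε (ℚ.<-≤-trans
           (∣p-q∣<δ⇒p<q+δ (s n) (s M) (close n M (≤ˡ M N ≤n) ℕ.≤-refl))
           (ℚ.+-monoˡ-≤ δ sM≤2δ)))
         (s>-ε n (≤ʳ M N ≤n)))
  where
  s = seq (value x)

-- Reciprocals of positive reals

-- Truncating the sequence from below by a positive ε that it eventually
-- exceeds makes it invertible everywhere without changing its limit.
module Reciprocal (s : ℕ → ℚ) {ε : ℚ} (0<ε : 0ℚ ℚ.< ε) where
  open ℚ.≤-Reasoning

  ε≤s⊔ε : ∀ n → ε ℚ.≤ s n ℚ.⊔ ε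
  ε≤s⊔ε n = ℚ.p≤q⊔p (s n) ε

  inverse : ∀ q → ε ℚ.≤ q → ∃ λ r → 0ℚ ℚ.< r × r ℚ.* q ≡ 1ℚ
  inverse q ε≤q = divide 1ℚ q 0<1 (ℚ.<-≤-trans 0<ε ε≤q)

  1/ε : ℚ
  1/ε = proj₁ (inverse ε ℚ.≤-refl)

  0<1/ε : 0ℚ ℚ.< 1/ε
  0<1/ε = proj₁ (proj₂ (inverse ε ℚ.≤-refl))

  1/s : ℕ → ℚ
  1/s n = proj₁ (inverse (s n ℚ.⊔ ε) (ε≤s⊔ε n))

  0<1/s : ∀ n → 0ℚ ℚ.< 1/s n
  0<1/s n = proj₁ (proj₂ (inverse (s n ℚ.⊔ ε) (ε≤s⊔ε n)))

  1/s*s≡1 : ∀ n → 1/s n ℚ.* (s n ℚ.⊔ ε) ≡ 1ℚ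
  1/s*s≡1 n = proj₂ (proj₂ (inverse (s n ℚ.⊔ ε) (ε≤s⊔ε n)))

  1/s≤1/ε : ∀ n → 1/s n ℚ.≤ 1/ε
  1/s≤1/ε n = ℚ.*-cancelʳ-≤-pos (s n ℚ.⊔ ε) {{ℚ.positive (ℚ.<-≤-trans 0<ε (ε≤s⊔ε n))}} (begin
    1/s n ℚ.* (s n ℚ.⊔ ε)   ≡⟨ 1/s*s≡1 n ⟩
    1ℚ                      ≡⟨ proj₂ (proj₂ (inverse ε ℚ.≤-refl)) ⟨
    1/ε ℚ.* ε               ≤⟨ ℚ.*-monoˡ-≤-nonNeg 1/ε {{ℚ.nonNegative (ℚ.<⇒≤ 0<1/ε)}} (ε≤s⊔ε n) ⟩
    1/ε ℚ.* (s n ℚ.⊔ ε)     ∎)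

  -- Where the truncation is inactive, `1/p - 1/q = (q - p) * (1/p * 1/q)`, and both reciprocals are
  -- at most `1/ε`.
  1/s-lipschitz : ∀ {m n} → ε ℚ.≤ s m → ε ℚ.≤ s n →
    ℚ.∣ 1/s m ℚ.- 1/s n ∣ ℚ.≤ ℚ.∣ s m ℚ.- s n ∣ ℚ.* (1/ε ℚ.* 1/ε)
  1/s-lipschitz {m} {n} ε≤sm ε≤sn = begin
    ℚ.∣ u ℚ.- v ∣
      ≡⟨ cong ℚ.∣_∣ (cong₂ ℚ._-_
           (trans (sym (ℚ.*-identityʳ u)) (cong (u ℚ.*_) (sym v*q≡1)))
           (trans (sym (ℚ.*-identityʳ v)) (cong (v ℚ.*_) (sym u*p≡1)))) ⟩
    ℚ.∣ u ℚ.* (v ℚ.* s n) ℚ.- v ℚ.* (u ℚ.* s m) ∣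
      ≡⟨ cong ℚ.∣_∣ (solve 4 (λ u v p q → u :* (v :* q) :- v :* (u :* p) := (q :- p) :* (u :* v)) refl u v (s m) (s n)) ⟩
    ℚ.∣ (s n ℚ.- s m) ℚ.* (u ℚ.* v) ∣
      ≡⟨ ℚ.∣p*q∣≡∣p∣*∣q∣ (s n ℚ.- s m) (u ℚ.* v) ⟩
    ℚ.∣ s n ℚ.- s m ∣ ℚ.* ℚ.∣ u ℚ.* v ∣
      ≡⟨ cong₂ ℚ._*_ (∣p-q∣≡∣q-p∣ (s n) (s m)) (ℚ.0≤p⇒∣p∣≡p (ℚ.<⇒≤ (*-pos (0<1/s m) (0<1/s n)))) ⟩
    ℚ.∣ s m ℚ.- s n ∣ ℚ.* (u ℚ.* v)
      ≤⟨ ℚ.*-monoˡ-≤-nonNeg ℚ.∣ s m ℚ.- s n ∣ {{ℚ.∣-∣-nonNeg (s m ℚ.- s n)}} (ℚ.≤-trans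
           (ℚ.*-monoʳ-≤-nonNeg v {{ℚ.nonNegative (ℚ.<⇒≤ (0<1/s n))}} (1/s≤1/ε m))
           (ℚ.*-monoˡ-≤-nonNeg 1/ε {{ℚ.nonNegative (ℚ.<⇒≤ 0<1/ε)}} (1/s≤1/ε n))) ⟩
    ℚ.∣ s m ℚ.- s n ∣ ℚ.* (1/ε ℚ.* 1/ε) ∎
    where
    u v : ℚ
    u = 1/s m
    v = 1/s n
    u*p≡1 : u ℚ.* s m ≡ 1ℚ
    u*p≡1 = trans (cong (u ℚ.*_) (sym (ℚ.p≥q⇒p⊔q≡p ε≤sm))) (1/s*s≡1 m)
    v*q≡1 : v ℚ.* s n ≡ 1ℚ
    v*q≡1 = trans (cong (v ℚ.*_) (sym (ℚ.p≥q⇒p⊔q≡p ε≤sn))) (1/s*s≡1 n)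

reciprocal : ∀ {x} → Positive x → ∃ λ y → y * x ≃ 1#
reciprocal {x} x>0 = mkℝ≥0 (mkℝ 1/s 1/s-cauchy) 1/s-nonNeg , wrap inverseˡ
  where
  s = seq (value x)
  ε = proj₁ (positive⇒above x>0)
  0<ε = proj₁ (proj₂ (positive⇒above x>0))
  M = proj₁ (proj₂ (proj₂ (positive⇒above x>0)))
  above : ∀ n → M ℕ.≤ n → ε ℚ.< s n
  above = proj₂ (proj₂ (proj₂ (positive⇒above x>0)))
  open Reciprocal s 0<ε

  1/s-cauchy : ∀ θ → 0ℚ ℚ.< θ →
    ∃ λ N → ∀ m n → N ℕ.≤ m → N ℕ.≤ n → ℚ.∣ 1/s m ℚ.- 1/s n ∣ ℚ.< θ
  1/s-cauchy θ 0<θ =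
    let B = 1/ε ℚ.* 1/ε
        0<B = *-pos 0<1/ε 0<1/ε
        δ , 0<δ , δ*B≡θ = divide θ B 0<θ 0<B
        N , close = cauchy (value x) δ 0<δ
    in M ⊔ N , λ m n ≤m ≤n → ℚ.≤-<-trans
         (1/s-lipschitz (ℚ.<⇒≤ (above m (≤ˡ M N ≤m))) (ℚ.<⇒≤ (above n (≤ˡ M N ≤n))))
         (subst (_ ℚ.<_) δ*B≡θ
           (ℚ.*-monoˡ-<-pos B {{ℚ.positive 0<B}} (close m n (≤ʳ M N ≤m) (≤ʳ M N ≤n))))

  1/s-nonNeg : 0ℝ ≤ℝ mkℝ 1/s 1/s-cauchy
  1/s-nonNeg θ 0<θ = 0 , λ n _ → +-pos (0<1/s n) 0<θ

  inverseˡ : mkℝ 1/s 1/s-cauchy *ℝ value x ≈ℝ value 1#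
  inverseˡ θ 0<θ = M , λ n M≤n → subst (ℚ._< θ)
    (sym (cong (λ t → ℚ.∣ t ℚ.- 1ℚ ∣)
      (trans (cong (1/s n ℚ.*_) (sym (ℚ.p≥q⇒p⊔q≡p (ℚ.<⇒≤ (above n M≤n))))) (1/s*s≡1 n))))
    0<θ

-- Finite sums

module SumProperties {c ℓ} (M : CommutativeMonoid c ℓ) where
  open CommutativeMonoid M
    using (Carrier; setoid; ∙-congˡ; identityʳ)
    renaming (_≈_ to _≈ᴹ_; _∙_ to _+ᴹ_; ε to 0ᴹ; trans to ≈ᴹ-trans)
  open Sum M using (sum; sum-cong-≋; sum-remove; sum-replicate-zero)

  sum-zero : ∀ {n} (t : Fin n → Carrier) → (∀ i → t i ≈ᴹ 0ᴹ) → sum t ≈ᴹ 0ᴹ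
  sum-zero {n} t t≈0 = ≈ᴹ-trans (sum-cong-≋ t≈0) (sum-replicate-zero n)

  -- The remainder can stay unnamed: over `ℝ≥0` it is non-negative by its type, which suffices for
  -- positivity of the sum.
  sum-split : ∀ {n} (t : Fin n → Carrier) i → ∃ λ rest → sum t ≈ᴹ t i +ᴹ rest
  sum-split {suc n} t i = _ , sum-remove {n} {i} t

  sum-single : ∀ {n} (t : Fin n → Carrier) i → (∀ j → j ≢ i → t j ≈ᴹ 0ᴹ) → sum t ≈ᴹ t i
  sum-single {suc n} t i t≈0 = begin
    sum t                               ≈⟨ sum-remove {n} {i} t ⟩
    t i +ᴹ sum (λ j → t (punchIn i j))  ≈⟨ ∙-congˡ (sum-zero _ λ j → t≈0 _ (punchInᵢ≢i i j)) ⟩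
    t i +ᴹ 0ᴹ                           ≈⟨ identityʳ (t i) ⟩
    t i                                 ∎
    where open SetoidReasoning setoid

open Sum +-0-commutativeMonoid using (sum; sum-cong-≋)
open SumProperties +-0-commutativeMonoid using (sum-zero; sum-split; sum-single)
open FinSet using (∑)

sum-positive : ∀ {n} (t : Fin n → ℝ≥0) i → Positive (t i) → Positive (sum t)
sum-positive t i tᵢ>0 =
  let rest , split = sum-split t i
  in positive-resp-≃ (≃.sym split) (+-positive (t i) rest tᵢ>0)

module _ (X : FinSet) where
  open FinSet X using (element; enumeration)
  open Inverse enumeration using (from; strictlyInverseˡ; strictlyInverseʳ)

  ∑-cong : ∀ g h → (∀ x → g x ≃ h x) → ∑ X g ≃ ∑ X h
  ∑-cong g h g≃h = sum-cong-≋ (λ i → g≃h (element i))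

  ∑-zero : ∀ g → (∀ x → g x ≃ 0#) → ∑ X g ≃ 0#
  ∑-zero g g≃0 = sum-zero (λ i → g (element i)) (λ i → g≃0 (element i))

  ∑-single : ∀ g x → (∀ y → y ≢ x → g y ≃ 0#) → ∑ X g ≃ g x
  ∑-single g x g≃0 = subst (λ y → ∑ X g ≃ g y) (strictlyInverseˡ x)
    (sum-single (λ i → g (element i)) (from x) λ i i≢ →
      g≃0 (element i) λ eᵢ≡x → i≢ (trans (sym (strictlyInverseʳ i)) (cong from eᵢ≡x)))

  ∑-positive : ∀ g x → Positive (g x) → Positive (∑ X g)
  ∑-positive g x gx>0 = sum-positive (λ i → g (element i)) (from x)
    (subst (λ y → Positive (g y)) (sym (strictlyInverseˡ x)) gx>0)

  module _ (p : ∣ X ∣ → Bool) where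

    count-zero : (∀ x → ¬ T (p x)) → FinSet.count X p ≡ 0
    count-zero ¬p = trans (cong Subset.∣_∣ (Subset.Empty-unique empty)) (Subset.∣⊥∣≡0 (FinSet.size X))
      where
      empty : Subset.Empty (tabulate (λ i → p (element i)))
      empty (i , i∈) = ¬p (element i) (Equivalence.from T-≡
        (trans (sym (lookup∘tabulate (λ i → p (element i)) i)) ([]=⇒lookup i∈)))

    count-positive : ∀ x → T (p x) → 0 ℕ.< FinSet.count X p
    -- Deleting a member strictly lowers the cardinality, so the cardinality was not zero.
    count-positive x px = ℕ.≤-<-trans ℕ.z≤n (Subset.x∈p⇒∣p-x∣<∣p∣
      (lookup⇒[]= (from x) (tabulate (λ i → p (element i)))
      (trans (lookup∘tabulate (λ i → p (element i)) (from x))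
        (trans (cong p (strictlyInverseˡ x)) (Equivalence.to T-≡ px)))))

-- Matrices

graph-≡ : ∀ X Y (h : ∣ X ∣ → ∣ Y ∣) {x y} → h x ≡ y → entry (graph {X} {Y} h) x y ≡ 1#
graph-≡ X Y h {x} {y} hx≡y = cong indicator (dec-true (FinSet._≟_ Y (h x) y) hx≡y)

graph-≢ : ∀ X Y (h : ∣ X ∣ → ∣ Y ∣) {x y} → h x ≢ y → entry (graph {X} {Y} h) x y ≡ 0#
graph-≢ X Y h {x} {y} hx≢y = cong indicator (dec-false (FinSet._≟_ Y (h x) y) hx≢y)

module _ {X Y Z : FinSet} (h : ∣ X ∣ → ∣ Y ∣) (M : Mat Y Z) where

  ∘ᴹ-graph : ∀ x z → entry (M ∘ᴹ graph {X} {Y} h) x z ≃ entry M (h x) z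
  ∘ᴹ-graph x z = ≃.trans
    (∑-single Y (λ y → entry (graph {X} {Y} h) x y * entry M y z) (h x) λ y y≢hx →
      *-zeroˡ (entry (graph {X} {Y} h) x y) (entry M y z)
        (≃.reflexive (graph-≢ X Y h (≢-sym y≢hx))))
    (*-unitˡ (entry (graph {X} {Y} h) x (h x)) (entry M (h x) z) (graph-≡ X Y h refl))

module _ {X Y Z : FinSet} (k : ∣ Y ∣ → ∣ Z ∣) (h : ∣ Z ∣ → ∣ Y ∣)
         (k∘h : ∀ z → k (h z) ≡ z) (h∘k : ∀ y → h (k y) ≡ y) (M : Mat X Y) where

  graph-∘ᴹ : ∀ x z → entry (graph {Y} {Z} k ∘ᴹ M) x z ≃ entry M x (h z)
  graph-∘ᴹ x z = ≃.trans
    (∑-single Y (λ y → entry M x y * entry (graph {Y} {Z} k) y z) (h z) λ y y≢hz →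
      *-zeroʳ (entry M x y) (entry (graph {Y} {Z} k) y z)
        (≃.reflexive (graph-≢ Y Z k λ ky≡z → y≢hz (trans (sym (h∘k y)) (cong h ky≡z)))))
    (*-unitʳ (entry M x (h z)) (entry (graph {Y} {Z} k) (h z) z) (graph-≡ Y Z k (k∘h z)))

module _ {X Y Z : FinSet} (g : Mat Y Z) (f : Mat X Y) where

  ∘ᴹ-row : ∀ x z (t : ∣ Y ∣ → ℝ≥0) → (∀ y → entry f x y ≃ t y) →
           entry (g ∘ᴹ f) x z ≃ ∑ Y (λ y → t y * entry g y z)
  ∘ᴹ-row x z t f≃t =
    ∑-cong Y (λ y → entry f x y * entry g y z) (λ y → t y * entry g y z) λ y →
      *-cong (entry f x y) (t y) (entry g y z) (entry g y z) (f≃t y) ≃.refl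

module _ {A A′ B B′ C C′ : FinSet}
         (f : Mat A′ B) (g : Mat B′ C′) (H : Mat A A′) (K : Mat B B′) (L : Mat C′ C) where

  -- Composing with the graph of a function on the source side, or of a bijection on the target
  -- side, only relabels indices. Of the four nested sums only the one between `f` and `g` remains.
  relabelled-∘ᴹ :
    (h : ∣ A ∣ → ∣ A′ ∣) (k : ∣ B ∣ → ∣ B′ ∣) (l : ∣ C′ ∣ → ∣ C ∣) →
    H ≡ graph h → K ≡ graph k → L ≡ graph l →
    (k⁻¹ : ∣ B′ ∣ → ∣ B ∣) → (∀ b → k (k⁻¹ b) ≡ b) → (∀ b → k⁻¹ (k b) ≡ b) →
    (l⁻¹ : ∣ C ∣ → ∣ C′ ∣) → (∀ c → l (l⁻¹ c) ≡ c) → (∀ c → l⁻¹ (l c) ≡ c) →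
    ∀ a c → entry (L ∘ᴹ g ∘ᴹ K ∘ᴹ f ∘ᴹ H) a c ≃
            ∑ B′ (λ b → entry f (h a) (k⁻¹ b) * entry g b (l⁻¹ c))
  relabelled-∘ᴹ h k l refl refl refl k⁻¹ k∘k⁻¹ k⁻¹∘k l⁻¹ l∘l⁻¹ l⁻¹∘l a c = ≃.trans
    (graph-∘ᴹ {A} {C′} {C} l l⁻¹ l∘l⁻¹ l⁻¹∘l (g ∘ᴹ K ∘ᴹ f ∘ᴹ H) a c)
    (∘ᴹ-row g (K ∘ᴹ f ∘ᴹ H) a (l⁻¹ c) (λ b → entry f (h a) (k⁻¹ b)) λ b → ≃.trans
      (graph-∘ᴹ {A} {B} {B′} k k⁻¹ k∘k⁻¹ k⁻¹∘k (f ∘ᴹ H) a b)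
      (∘ᴹ-graph {A} {A′} h f a (k⁻¹ b)))

id-≡ : ∀ X x → entry (idᴹ {X}) x x ≡ 1#
id-≡ X x = graph-≡ X X (λ x → x) refl

id-≢ : ∀ X x y → x ≢ y → entry (idᴹ {X}) x y ≃ 0#
id-≢ X x y x≢y = ≃.reflexive (graph-≢ X X (λ x → x) x≢y)

id-positive : ∀ X x → Positive (entry (idᴹ {X}) x x)
id-positive X x = subst Positive (sym (id-≡ X x)) 1#-positive

-- Snake identities

-- _≈_ depends only on the underlying sequences, so matrix products are compared
-- through their sequences: comparing them as elements of ℝ≥0 would make Agda
-- convert the Cauchy moduli of products, which is infeasible.
sum-≗ : ∀ k {u v : Fin k → ℝ≥0} → (∀ i → seq (value (u i)) ≗ seq (value (v i))) →
        seq (value (sum u)) ≗ seq (value (sum v))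
sum-≗ zero    u≗v n = refl
sum-≗ (suc k) u≗v n = cong₂ ℚ._+_ (u≗v zero n) (sum-≗ k (λ i → u≗v (suc i)) n)

-- An entry of an iterated composite is a sum of products whose first factors are again such sums,
-- so one application handles one composition.
sum-*-≗ : ∀ k {u v : Fin k → ℝ≥0} {s t : ℕ → ℚ} →
          (∀ i → seq (value (u i)) ≗ seq (value (v i))) → s ≗ t →
          (λ n → seq (value (sum u)) n ℚ.* s n) ≗ (λ n → seq (value (sum v)) n ℚ.* t n)
sum-*-≗ k u≗v s≗t n = cong₂ ℚ._*_ (sum-≗ k u≗v n) (s≗t n)

*-sum-≗ : ∀ k {u v : Fin k → ℝ≥0} (s : ℕ → ℚ) →
          (∀ i → seq (value (u i)) ≗ seq (value (v i))) →
          (λ n → s n ℚ.* seq (value (sum u)) n) ≗ (λ n → s n ℚ.* seq (value (sum v)) n)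
*-sum-≗ k s u≗v n = cong (s n ℚ.*_) (sum-≗ k u≗v n)

sum-≈ : ∀ k {u v : Fin k → ℝ≥0} z → (∀ i → seq (value (u i)) ≗ seq (value (v i))) →
        sum u ≈ z → sum v ≈ z
sum-≈ k z u≗v u≈z ε 0<ε = let N , close = u≈z ε 0<ε in
  N , λ n N≤n → subst (λ t → ℚ.∣ t ℚ.- seq (value z) n ∣ ℚ.< ε) (sum-≗ k u≗v n) (close n N≤n)

-- `E` and `H` are the matrices of ε and η. Once the identity factors are evaluated, the entry `a c`
-- of `snake₁` is that of the matrix product `EH`, and the entry `a c` of `snake₂` is the entry
-- `c a` of `HE`.
module Snake (S : FinSet) (E : ∣ S ∣ → ∣ S ∣ → ℝ≥0) (H : ∣ S ∣ → ∣ S ∣ → ℝ≥0) where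

  id⊗η : Mat (S ⊗ I) (S ⊗ (S ⊗ S))
  id⊗η = mkMat λ (a , _) (p , (q , r)) → entry (idᴹ {S}) a p * H q r

  η⊗id : Mat (I ⊗ S) ((S ⊗ S) ⊗ S)
  η⊗id = mkMat λ (_ , a) ((p , q) , r) → H p q * entry (idᴹ {S}) a r

  ε⊗id : Mat ((S ⊗ S) ⊗ S) (I ⊗ S)
  ε⊗id = mkMat λ ((p , q) , r) (_ , c) → E p q * entry (idᴹ {S}) r c

  id⊗ε : Mat (S ⊗ (S ⊗ S)) (S ⊗ I)
  id⊗ε = mkMat λ (p , (q , r)) (c , _) → entry (idᴹ {S}) p c * E q r

  snake₁ snake₂ : Mat S S
  snake₁ = graph {I ⊗ S} {S} proj₂ ∘ᴹ ε⊗id ∘ᴹ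
           graph {S ⊗ (S ⊗ S)} {(S ⊗ S) ⊗ S} assocˡ′ ∘ᴹ id⊗η ∘ᴹ graph {S} {S ⊗ I} (_, tt)
  snake₂ = graph {S ⊗ I} {S} proj₁ ∘ᴹ id⊗ε ∘ᴹ
           graph {(S ⊗ S) ⊗ S} {S ⊗ (S ⊗ S)} assocʳ′ ∘ᴹ η⊗id ∘ᴹ graph {S} {I ⊗ S} (tt ,_)

  -- The bracketings are spelled out rather than taken from assocʳ′ and assocˡ′,
  -- so that a term at a tuple unfolds to a product whose factors match
  -- syntactically; converting unequal products would compare Cauchy moduli.
  term₁ : ∣ S ∣ → ∣ S ∣ → ∣ (S ⊗ S) ⊗ S ∣ → ℝ≥0
  term₁ a c w =
    entry id⊗η (a , tt) (proj₁ (proj₁ w) , (proj₂ (proj₁ w) , proj₂ w)) * entry ε⊗id w (tt , c)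

  term₂ : ∣ S ∣ → ∣ S ∣ → ∣ S ⊗ (S ⊗ S) ∣ → ℝ≥0
  term₂ a c w =
    entry η⊗id (tt , a) ((proj₁ w , proj₁ (proj₂ w)) , proj₂ (proj₂ w)) * entry id⊗ε w (c , tt)

  snake₁-entry : ∀ a c → entry snake₁ a c ≃ ∑ ((S ⊗ S) ⊗ S) (term₁ a c)
  snake₁-entry = relabelled-∘ᴹ id⊗η ε⊗id
    (graph {S} {S ⊗ I} (_, tt)) (graph {S ⊗ (S ⊗ S)} {(S ⊗ S) ⊗ S} assocˡ′) (graph {I ⊗ S} {S} proj₂)
    (_, tt) assocˡ′ proj₂ refl refl refl
    (λ ((p , q) , r) → p , (q , r)) (λ _ → refl) (λ _ → refl) (tt ,_) (λ _ → refl) (λ _ → refl)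

  snake₂-entry : ∀ a c → entry snake₂ a c ≃ ∑ (S ⊗ (S ⊗ S)) (term₂ a c)
  snake₂-entry = relabelled-∘ᴹ η⊗id id⊗ε
    (graph {S} {I ⊗ S} (tt ,_)) (graph {(S ⊗ S) ⊗ S} {S ⊗ (S ⊗ S)} assocʳ′) (graph {S ⊗ I} {S} proj₁)
    (tt ,_) assocʳ′ proj₁ refl refl refl
    (λ (p , (q , r)) → (p , q) , r) (λ _ → refl) (λ _ → refl) (_, tt) (λ _ → refl) (λ _ → refl)

  term₁-diagonal : ∀ a q c → term₁ a c ((a , q) , c) ≃ H q c * E a q
  term₁-diagonal a q c =
    *-cong (entry id⊗η (a , tt) (a , (q , c))) (H q c) (entry ε⊗id ((a , q) , c) (tt , c)) (E a q)
      (*-unitˡ (entry (idᴹ {S}) a a) (H q c) (id-≡ S a))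
      (*-unitʳ (E a q) (entry (idᴹ {S}) c c) (id-≡ S c))

  term₂-diagonal : ∀ a q c → term₂ a c (c , (q , a)) ≃ H c q * E q a
  term₂-diagonal a q c =
    *-cong (entry η⊗id (tt , a) ((c , q) , a)) (H c q) (entry id⊗ε (c , (q , a)) (c , tt)) (E q a)
      (*-unitʳ (H c q) (entry (idᴹ {S}) a a) (id-≡ S a))
      (*-unitˡ (entry (idᴹ {S}) c c) (E q a) (id-≡ S c))

  -- Decisions are passed to auxiliary functions: abstracting them with `with`
  -- would normalise the products in the goal.
  term₁-zero : ∀ a c p q r → (p ≡ a → r ≡ c → H q c ≃ 0# ⊎ E a q ≃ 0#) →
               term₁ a c ((p , q) , r) ≃ 0#
  term₁-zero a c p q r HE≃0 = go p r (FinSet._≟_ S p a) (FinSet._≟_ S r c) HE≃0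
    where
    go′ : H q c ≃ 0# ⊎ E a q ≃ 0# → term₁ a c ((a , q) , c) ≃ 0#
    go′ (inj₁ H≃0) =
      *-zeroˡ (entry id⊗η (a , tt) (a , (q , c))) (entry ε⊗id ((a , q) , c) (tt , c))
        (*-zeroʳ (entry (idᴹ {S}) a a) (H q c) H≃0)
    go′ (inj₂ E≃0) =
      *-zeroʳ (entry id⊗η (a , tt) (a , (q , c))) (entry ε⊗id ((a , q) , c) (tt , c))
        (*-zeroˡ (E a q) (entry (idᴹ {S}) c c) E≃0)

    go : ∀ p r → Dec (p ≡ a) → Dec (r ≡ c) → (p ≡ a → r ≡ c → H q c ≃ 0# ⊎ E a q ≃ 0#) →
         term₁ a c ((p , q) , r) ≃ 0#
    go p r (no p≢a) _ _ =
      *-zeroˡ (entry id⊗η (a , tt) (p , (q , r))) (entry ε⊗id ((p , q) , r) (tt , c))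
        (*-zeroˡ (entry (idᴹ {S}) a p) (H q r) (id-≢ S a p (≢-sym p≢a)))
    go p r (yes _) (no r≢c) _ =
      *-zeroʳ (entry id⊗η (a , tt) (p , (q , r))) (entry ε⊗id ((p , q) , r) (tt , c))
        (*-zeroʳ (E p q) (entry (idᴹ {S}) r c) (id-≢ S r c r≢c))
    go p r (yes refl) (yes refl) HE≃0 = go′ (HE≃0 refl refl)

  term₂-zero : ∀ a c p q r → (p ≡ c → r ≡ a → H c q ≃ 0#) → term₂ a c (p , (q , r)) ≃ 0#
  term₂-zero a c p q r H≃0 = go p r (FinSet._≟_ S p c) (FinSet._≟_ S r a) H≃0
    where
    go : ∀ p r → Dec (p ≡ c) → Dec (r ≡ a) → (p ≡ c → r ≡ a → H c q ≃ 0#) →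
         term₂ a c (p , (q , r)) ≃ 0#
    go p r (no p≢c) _ _ =
      *-zeroʳ (entry η⊗id (tt , a) ((p , q) , r)) (entry id⊗ε (p , (q , r)) (c , tt))
        (*-zeroˡ (entry (idᴹ {S}) p c) (E q r) (id-≢ S p c p≢c))
    go p r (yes _) (no r≢a) _ =
      *-zeroˡ (entry η⊗id (tt , a) ((p , q) , r)) (entry id⊗ε (p , (q , r)) (c , tt))
        (*-zeroʳ (H p q) (entry (idᴹ {S}) a r) (id-≢ S a r (≢-sym r≢a)))
    go p r (yes refl) (yes refl) H≃0 =
      *-zeroˡ (entry η⊗id (tt , a) ((c , q) , a)) (entry id⊗ε (c , (q , a)) (c , tt))
        (*-zeroˡ (H c q) (entry (idᴹ {S}) a a) (H≃0 refl refl))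

  -- Two positive entries in row a of E would force column a of its inverse H to vanish.
  module _ (snake₁≃id : ∀ a c → entry snake₁ a c ≃ entry (idᴹ {S}) a c)
           (snake₂≃id : ∀ a c → entry snake₂ a c ≃ entry (idᴹ {S}) a c) where

    -- Were `H q a` positive, `H q a * E a b` would be a positive term in the entry `b q` of
    -- `snake₂`. Non-negative terms cannot cancel, yet the identity has 0 there.
    H-column-zero : ∀ {a b} → Positive (E a b) → ∀ q → b ≢ q → H q a ≃ 0#
    H-column-zero {a} {b} Eab>0 q b≢q = ¬positive⇒≃0 λ Hqa>0 → ≃0⇒¬positive
      (≃.trans (≃.trans (≃.sym (snake₂-entry b q)) (snake₂≃id b q)) (id-≢ S b q b≢q))
      (∑-positive (S ⊗ (S ⊗ S)) (term₂ b q) (q , (a , b))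
        (positive-resp-≃ (≃.sym (term₂-diagonal b a q)) (*-positive (H q a) (E a b) Hqa>0 Eab>0)))

    -- A vanishing column would kill every term of the diagonal entry of `snake₁` at `a`, which has
    -- to be 1.
    H-column-nonzero : ∀ a → ¬ (∀ q → H q a ≃ 0#)
    H-column-nonzero a H≃0 = ≃0⇒¬positive
      (∑-zero ((S ⊗ S) ⊗ S) (term₁ a a) λ { ((p , q) , r) →
        term₁-zero a a p q r λ _ _ → inj₁ (H≃0 q) })
      (positive-resp-≃ (≃.trans (≃.sym (snake₁≃id a a)) (snake₁-entry a a)) (id-positive S a))

    E-row-unique : ∀ {a b c} → Positive (E a b) → Positive (E a c) → b ≡ c
    E-row-unique {a} {b} {c} Eab>0 Eac>0 = decidable-stable (FinSet._≟_ S b c) λ b≢c →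
      -- Since `b` and `c` differ, each `q` differs from at least one of them, and the positive
      -- entry at that one forces `H q a` to vanish.
      H-column-nonzero a λ q → case FinSet._≟_ S b q of λ where
        (yes b≡q) → H-column-zero Eac>0 q λ c≡q → b≢c (trans b≡q (sym c≡q))
        (no b≢q)  → H-column-zero Eab>0 q b≢q

  module _ (σ : ∣ S ∣ → ∣ S ∣) (σ-involutive : ∀ a → σ (σ a) ≡ a)
           (E-zero : ∀ {a b} → b ≢ σ a → E a b ≃ 0#)
           (H-zero : ∀ {a b} → a ≢ σ b → H a b ≃ 0#)
           (H*E≃1 : ∀ a → H (σ a) a * E a (σ a) ≃ 1#) where

    -- The support of `E` leaves only the middle index `σ a`. The remaining factor `H (σ a) c`
    -- vanishes unless `σ a = σ c`, hence unless `a = c`, as an involution is injective.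
    monomial⇒snake₁ : ∀ a c → entry snake₁ a c ≃ entry (idᴹ {S}) a c
    monomial⇒snake₁ a c = begin
      entry snake₁ a c
        ≈⟨ snake₁-entry a c ⟩
      ∑ ((S ⊗ S) ⊗ S) (term₁ a c)
        ≈⟨ ∑-single ((S ⊗ S) ⊗ S) (term₁ a c) ((a , σ a) , c) (λ { ((p , q) , r) w≢ →
             term₁-zero a c p q r λ { refl refl → inj₂ (E-zero λ { refl → w≢ refl }) } }) ⟩
      term₁ a c ((a , σ a) , c)
        ≈⟨ term₁-diagonal a (σ a) c ⟩
      H (σ a) c * E a (σ a)
        ≈⟨ product (FinSet._≟_ S a c) ⟩
      entry (idᴹ {S}) a c ∎
      where
      open ≃-Reasoning
      product : Dec (a ≡ c) → H (σ a) c * E a (σ a) ≃ entry (idᴹ {S}) a c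
      product (yes refl) = ≃.trans (H*E≃1 a) (≃.reflexive (sym (id-≡ S a)))
      product (no a≢c) = ≃.trans
        (*-zeroˡ (H (σ a) c) (E a (σ a)) (H-zero λ σa≡σc → a≢c
          (trans (sym (σ-involutive a)) (trans (cong σ σa≡σc) (σ-involutive c)))))
        (≃.sym (id-≢ S a c a≢c))

    -- Here the support of `H` selects the middle index `σ c`, and the support of `E` decides
    -- whether the surviving term vanishes.
    monomial⇒snake₂ : ∀ a c → entry snake₂ a c ≃ entry (idᴹ {S}) a c
    monomial⇒snake₂ a c = begin
      entry snake₂ a c
        ≈⟨ snake₂-entry a c ⟩
      ∑ (S ⊗ (S ⊗ S)) (term₂ a c)
        ≈⟨ ∑-single (S ⊗ (S ⊗ S)) (term₂ a c) (c , (σ c , a)) (λ { (p , (q , r)) w≢ →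
             term₂-zero a c p q r λ { refl refl → H-zero λ c≡σq → w≢
               (cong (λ t → c , (t , a)) (trans (sym (σ-involutive q)) (cong σ (sym c≡σq)))) } }) ⟩
      term₂ a c (c , (σ c , a))
        ≈⟨ term₂-diagonal a (σ c) c ⟩
      H c (σ c) * E (σ c) a
        ≈⟨ product (FinSet._≟_ S a c) ⟩
      entry (idᴹ {S}) a c ∎
      where
      open ≃-Reasoning
      product : Dec (a ≡ c) → H c (σ c) * E (σ c) a ≃ entry (idᴹ {S}) a c
      product (yes refl) = ≃.trans
        -- The product is known in one order of indices only; the other order is the case `σ a`,
        -- with `σ (σ a)` rewritten to `a`.
        (subst (λ d → H d (σ a) * E (σ a) d ≃ 1#) (σ-involutive a) (H*E≃1 (σ a)))
        (≃.reflexive (sym (id-≡ S a)))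
      product (no a≢c) = ≃.trans
        (*-zeroʳ (H c (σ c)) (E (σ c) a) (E-zero λ a≡σσc → a≢c (trans a≡σσc (σ-involutive c))))
        (≃.sym (id-≢ S a c a≢c))

-- Inverses of monomial matrices

IsDual : (S : FinSet) (E H : ∣ S ∣ → ∣ S ∣ → ℝ≥0) → Set
IsDual S E H = (∀ a c → entry snake₁ a c ≃ entry (idᴹ {S}) a c) ×
               (∀ a c → entry snake₂ a c ≃ entry (idᴹ {S}) a c)
  where open Snake S E H

module _ (S : FinSet) (E : ∣ S ∣ → ∣ S ∣ → ℝ≥0)
         (σ : ∣ S ∣ → ∣ S ∣) (σ-involutive : ∀ a → σ (σ a) ≡ a)
         (E-zero : ∀ {a b} → b ≢ σ a → E a b ≃ 0#) where

  module _ (i : ∣ S ∣ → ℝ≥0) (i*E≃1 : ∀ a → i a * E a (σ a) ≃ 1#) where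

    -- The inverse of a monomial matrix: the reciprocal entries `i` at the transposed positions
    -- `(σ b , b)`.
    H : ∣ S ∣ → ∣ S ∣ → ℝ≥0
    H a b = entry (idᴹ {S}) a (σ b) * i b

    H-zero : ∀ {a b} → a ≢ σ b → H a b ≃ 0#
    H-zero {a} {b} a≢σb = *-zeroˡ (entry (idᴹ {S}) a (σ b)) (i b) (id-≢ S a (σ b) a≢σb)

    H*E≃1 : ∀ a → H (σ a) a * E a (σ a) ≃ 1#
    H*E≃1 a = ≃.trans
      (*-cong (H (σ a) a) (i a) (E a (σ a)) (E a (σ a))
        (*-unitˡ (entry (idᴹ {S}) (σ a) (σ a)) (i a) (id-≡ S (σ a))) ≃.refl)
      (i*E≃1 a)

    isDual : IsDual S E H
    isDual = Snake.monomial⇒snake₁ S E H σ σ-involutive E-zero H-zero H*E≃1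
           , Snake.monomial⇒snake₂ S E H σ σ-involutive E-zero H-zero H*E≃1

  monomial⇒dual : (∀ a → ∃ λ y → y * E a (σ a) ≃ 1#) → ∃ (IsDual S E)
  monomial⇒dual inverse =
    H (λ a → proj₁ (inverse a)) (λ a → proj₂ (inverse a)) ,
    isDual (λ a → proj₁ (inverse a)) (λ a → proj₂ (inverse a))

-- The pairing of a form

module Form (M : RawMonoidObject) (f : Mat (RawMonoidObject.object M) I) where
  open RawMonoidObject M using (mult) renaming (object to S)
  open FinSet using (size; element)

  pairing : ∣ S ∣ → ∣ S ∣ → ℝ≥0
  pairing a b = ∑ S (λ c → entry mult (a , b) c * entry f c tt)

  pairing-positive : ∀ a b c → Positive (entry mult (a , b) c) → Positive (entry f c tt) →
                     Positive (pairing a b)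
  pairing-positive a b c ∇>0 fc>0 =
    ∑-positive S (λ c → entry mult (a , b) c * entry f c tt) c
      (*-positive (entry mult (a , b) c) (entry f c tt) ∇>0 fc>0)

  pairing-zero : ∀ a b → (∀ c → entry mult (a , b) c ≃ 0# ⊎ entry f c tt ≃ 0#) → pairing a b ≃ 0#
  pairing-zero a b zero? = ∑-zero S (λ c → entry mult (a , b) c * entry f c tt) λ c →
    [ *-zeroˡ (entry mult (a , b) c) (entry f c tt)
    , *-zeroʳ (entry mult (a , b) c) (entry f c tt) ]′ (zero? c)

  -- The nesting of the sums is that of the four compositions in a snake identity,
  -- with the pairing as one further sum inside the second.
  nonDegenerate⇒dual : IsNonDegenerateForm M f → ∃ (IsDual S pairing)
  nonDegenerate⇒dual (η , s₁ , s₂) = (λ a b → entry η tt (a , b)) ,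
    (λ a c → wrap (sum-≈ (size (I ⊗ S)) (entry (idᴹ {S}) a c)
      (λ _ → sum-*-≗ (size ((S ⊗ S) ⊗ S))
        (λ _ → sum-*-≗ (size (S ⊗ (S ⊗ S)))
          (λ _ → sum-*-≗ (size (S ⊗ I)) (λ _ _ → refl) (λ _ → refl))
          (sum-*-≗ (size S) (λ _ _ → refl) (λ _ → refl)))
        (λ _ → refl))
      (s₁ a c))) ,
    (λ a c → wrap (sum-≈ (size (S ⊗ I)) (entry (idᴹ {S}) a c)
      (λ i → sum-*-≗ (size (S ⊗ (S ⊗ S)))
        (λ j → sum-*-≗ (size ((S ⊗ S) ⊗ S))
          (λ _ → sum-*-≗ (size (I ⊗ S)) (λ _ _ → refl) (λ _ → refl))
          -- In `id⊗ε` the pairing is the right factor, so the identity entry to its left is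
          -- supplied explicitly.
          (*-sum-≗ (size S)
            (seq (value (entry (idᴹ {S}) (proj₁ (element (S ⊗ (S ⊗ S)) j)) (proj₁ (element (S ⊗ I) i)))))
            (λ _ _ → refl)))
        (λ _ → refl))
      (s₂ a c)))

  dual⇒nonDegenerate : ∃ (IsDual S pairing) → IsNonDegenerateForm M f
  dual⇒nonDegenerate (H , s₁ , s₂) = mkMat (λ _ (a , b) → H a b) ,
    (λ a c → sum-≈ (size (I ⊗ S)) (entry (idᴹ {S}) a c)
      (λ _ → sum-*-≗ (size ((S ⊗ S) ⊗ S))
        (λ _ → sum-*-≗ (size (S ⊗ (S ⊗ S)))
          (λ _ → sum-*-≗ (size (S ⊗ I)) (λ _ _ → refl) (λ _ → refl))
          (sum-*-≗ (size S) (λ _ _ → refl) (λ _ → refl)))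
        (λ _ → refl))
      (unwrap (s₁ a c))) ,
    (λ a c → sum-≈ (size (S ⊗ I)) (entry (idᴹ {S}) a c)
      (λ i → sum-*-≗ (size (S ⊗ (S ⊗ S)))
        (λ j → sum-*-≗ (size ((S ⊗ S) ⊗ S))
          (λ _ → sum-*-≗ (size (I ⊗ S)) (λ _ _ → refl) (λ _ → refl))
          (*-sum-≗ (size S)
            (seq (value (entry (idᴹ {S}) (proj₁ (element (S ⊗ (S ⊗ S)) j)) (proj₁ (element (S ⊗ I) i)))))
            (λ _ _ → refl)))
        (λ _ → refl))
      (unwrap (s₂ a c)))

  nonDegenerate⇒row-unique : IsNonDegenerateForm M f →
    ∀ {a b c} → Positive (pairing a b) → Positive (pairing a c) → b ≡ c
  nonDegenerate⇒row-unique nd =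
    let H , s₁ , s₂ = nonDegenerate⇒dual nd in Snake.E-row-unique S pairing H s₁ s₂

  monomial⇒nonDegenerate :
    (σ : ∣ S ∣ → ∣ S ∣) → (∀ a → σ (σ a) ≡ a) →
    (∀ {a b} → b ≢ σ a → pairing a b ≃ 0#) → (∀ a → Positive (pairing a (σ a))) →
    IsNonDegenerateForm M f
  monomial⇒nonDegenerate σ σ-involutive E-zero E-positive = dual⇒nonDegenerate
    (monomial⇒dual S pairing σ σ-involutive E-zero λ a → reciprocal (E-positive a))

-- Coherent configurations and non-degeneracy

T-iff⇒≡ : ∀ {b c} → (T b → T c) → (T c → T b) → b ≡ c
T-iff⇒≡ {b} {c} b⇒c c⇒b = ⇔→≡ (mk⇔
  (Equivalence.to T-≡ ∘ b⇒c ∘ Equivalence.from T-≡)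
  (Equivalence.to T-≡ ∘ c⇒b ∘ Equivalence.from T-≡))

module _ {X : FinSet} (𝒮 : SubsetFamily X) where
  open SubsetFamily 𝒮

  module _ (cc1 : CC1 𝒮) (cc2 : CC2 𝒮) (cc3 : CC3 𝒮) (f : Mat S I)
           (f>0 : ∀ a → (0# < entry f a tt) ⇔ (a ⊆id)) where
    open CC1 cc1
    open Form (associatedMonoid 𝒮 cc1) f

    f-zero : ∀ a → ¬ (a ⊆id) → entry f a tt ≃ 0#
    f-zero a a⊈id = ¬positive⇒≃0 λ fa>0 → a⊈id (Equivalence.to (f>0 a) (unwrap⁺ fa>0))

    -- The class `c` of `(x , x)` lies in the diagonal by CC2, so `f` is positive on it. The point
    -- `y` is a path from `x` back to `x` through `a` and `b`, and CC3 carries this count to the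
    -- pair at which `∇` is evaluated.
    opposite⇒pairing-positive : ∀ {a b x y} → x , y ∈ a → y , x ∈ b → Positive (pairing a b)
    opposite⇒pairing-positive {a} {b} {x} {y} xy∈a yx∈b =
      let c , xx∈c = covering x x
      in pairing-positive a b c
           (fromℕ-positive (subst (0 ℕ.<_) (∇-independent 𝒮 cc1 cc3 a b c xx∈c)
             (count-positive X (λ z → member a x z ∧ member b z x) y
               (Equivalence.from T-∧ (xy∈a , yx∈b)))))
           (wrap⁺ (Equivalence.from (f>0 c) (cc2 c (x , xx∈c))))

    -- Off the diagonal `f` vanishes. For a diagonal class, `∇` counts closed paths `x`, `z`, `x`,
    -- and each of them would exhibit an opposite pair.
    no-opposite⇒pairing-zero : ∀ {a b} → (∀ {x y} → x , y ∈ a → ¬ (y , x ∈ b)) → pairing a b ≃ 0#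
    no-opposite⇒pairing-zero {a} {b} no-opposite = pairing-zero a b λ c → zero? c (c ⊆id?)
      where
      zero? : ∀ c → Dec (c ⊆id) → fromℕ (∇ 𝒮 cc1 a b c) ≃ 0# ⊎ entry f c tt ≃ 0#
      zero? c (no c⊈id)  = inj₂ (f-zero c c⊈id)
      zero? c (yes c⊆id) =
        let x , y , xy∈c = nonempty c
        in inj₁ (≃.reflexive (cong fromℕ
             (count-zero X (λ z → member a x z ∧ member b z y) λ z paths →
               let xz∈a , zy∈b = Equivalence.to T-∧ paths
               in no-opposite xz∈a (subst (λ t → z , t ∈ b) (sym (c⊆id x y xy∈c)) zy∈b))))

    nonDegenerate⇒CC4 : IsNonDegenerateForm (associatedMonoid 𝒮 cc1) f → CC4 𝒮
    nonDegenerate⇒CC4 nd c =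
      let x₀ , y₀ , x₀y₀∈c = nonempty c
          d , y₀x₀∈d = covering y₀ x₀
      -- The candidate inverse is the class of one reversed pair of `c`. Uniqueness in row `d` of
      -- the pairing shows that reversed pairs of `d` lie in `c`; uniqueness in row `c` gives the
      -- converse.
      in d , λ x y → T-iff⇒≡
           (λ yx∈d → let c′ , xy∈c′ = covering x y in
             subst (λ t → x , y ∈ t)
               (unique (opposite⇒pairing-positive yx∈d xy∈c′)
                       (opposite⇒pairing-positive y₀x₀∈d x₀y₀∈c)) xy∈c′)
           (λ xy∈c → let d′ , yx∈d′ = covering y x in
             subst (λ t → y , x ∈ t)
               (unique (opposite⇒pairing-positive xy∈c yx∈d′)
                       (opposite⇒pairing-positive x₀y₀∈c y₀x₀∈d)) yx∈d′)
      where
      unique : ∀ {a b b′} → Positive (pairing a b) → Positive (pairing a b′) → b ≡ b′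
      unique = nonDegenerate⇒row-unique nd

    CC4⇒nonDegenerate : CC4 𝒮 → IsNonDegenerateForm (associatedMonoid 𝒮 cc1) f
    CC4⇒nonDegenerate cc4 = monomial⇒nonDegenerate _⁻¹ involutive E-zero E-positive
      where
      _⁻¹ : ∣ S ∣ → ∣ S ∣
      a ⁻¹ = proj₁ (cc4 a)

      opposite : ∀ a x y → member (a ⁻¹) y x ≡ member a x y
      opposite a = proj₂ (cc4 a)

      involutive : ∀ a → (a ⁻¹) ⁻¹ ≡ a
      -- Reversing twice restores the subset, and a subset determines its index.
      involutive a = distinct λ x y → trans (opposite (a ⁻¹) y x) (opposite a x y)

      E-positive : ∀ a → Positive (pairing a (a ⁻¹))
      E-positive a =
        let x , y , xy∈a = nonempty a
        in opposite⇒pairing-positive xy∈a (subst T (sym (opposite a x y)) xy∈a)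

      E-zero : ∀ {a b} → b ≢ a ⁻¹ → pairing a b ≃ 0#
      E-zero {a} b≢a⁻¹ = no-opposite⇒pairing-zero λ {x} {y} xy∈a yx∈b →
        -- An opposite pair would lie in both `b` and `a ⁻¹`, making these classes equal.
        b≢a⁻¹ (disjoint yx∈b (subst T (sym (opposite a x y)) xy∈a))

theorem3p2 : (X : FinSet) (𝒮 : SubsetFamily X) →
    let open SubsetFamily 𝒮 in
    (cc1 : CC1 𝒮) → CC2 𝒮 → CC3 𝒮 →
    (f : Mat S I) → (∀ a → (0# < entry f a tt) ⇔ (a ⊆id)) →
    (IsNonDegenerateForm (associatedMonoid 𝒮 cc1) f ⇔ IsCoherentConfiguration 𝒮) ×
    (IsNonDegenerateForm (associatedMonoid 𝒮 cc1) f ⇔ CC4 𝒮)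
theorem3p2 X 𝒮 cc1 cc2 cc3 f f>0 =
  mk⇔ (λ nd → record { cc1 = cc1 ; cc2 = cc2 ; cc3 = cc3 ; cc4 = to nd })
      (λ coherent → from (IsCoherentConfiguration.cc4 coherent)) ,
  mk⇔ to from
  where
  to   = nonDegenerate⇒CC4 𝒮 cc1 cc2 cc3 f f>0
  from = CC4⇒nonDegenerate 𝒮 cc1 cc2 cc3 f f>0
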